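{- There is a partial feedback computable function $G$ such that for any $X,Y\in{}^{\omega}2$, and for all $\gamma=\langle e^0,m^0,X\rangle$ and $\delta=\langle e^1,m^1,Y\rangle$ (with $e^0,m^0,e^1,m^1\in\omega$): (i) if $\rho(\gamma)<\omega_1$ and $\rho(\gamma)\le\rho(\delta)$, then $G(\gamma,\delta)\simeq 0$; (ii) if $\rho(\delta)<\omega_1$ and $\rho(\delta)<\rho(\gamma)$, then $G(\gamma,\delta)\simeq 1$.
   Context: **Feedback computation.** Programs are ordinary oracle Turing machine programs (with oracle $X$), indexed by $e\in\omega$ in a standard way, with an additional instruction allowing the machine at any stage to issue a query $Q^X(e',m')$, with $e',m'$ integers computed by the machine, asking whether the feedback computation $\langle e'\rangle^X(m')$ converges or diverges, and receiving (in one step) an answer in $\{\downarrow,\uparrow\}$. Finite sequences of integers are coded by integers. Formally, for a partial function $C$ let $I(C)$ be the set of pairs $\langle\langle e,m,X\rangle,\langle j,k\rangle\rangle$ such that program $e$, run on input $m$ with oracle $X$, makes only queries $Q^X(e',m')$ for which $C(\langle e',m',X\rangle)=\langle j',k'\rangle$ is defined, each such query being answered by $j'$, and either this run halts with output $k\in\omega$ and $j=\,\downarrow$, or it runs forever and $j=\,\uparrow$, $k=\omega$. Set $I_0=\emptyset$ at the start of the iteration in the sense $I_{<\alpha}=\bigcup_{\beta<\alpha}I_\beta$ and $I_\alpha=I(I_{<\alpha})$, so that the computations of rank $0$ (defined next) are exactly those making no queries; let $I_\infty$ be the resulting least fixed point. Write $\langle e\rangle^X(m)\downarrow k$, or $\langle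 e\rangle^X(m)\simeq k$, iff $I_\infty(\langle e,m,X\rangle)=\langle\downarrow,k\rangle$. **Rank.** $\rho(e,m,X)$ is the least $\alpha$ such that $\langle\langle e,m,X\rangle,\langle j,k\rangle\rangle\in I_\alpha$ for some $\langle j,k\rangle$; if there is no such $\alpha$, i.e. $\langle e,m,X\rangle\notin\mathrm{dom}(I_\infty)$, set $\rho(e,m,X)=\omega_1$. (All defined ranks are countable ordinals.) **Partial feedback computable function of $\gamma,\delta$.** This means that there is a single index $g\in\omega$ such that for all arguments $G(\langle e^0,m^0,X\rangle,\langle e^1,m^1,Y\rangle)\simeq\langle g\rangle^{X\oplus Y}(e^0,m^0,e^1,m^1)$, i.e. the integers are the inputs and $X,Y$ are available as oracles ($X\oplus Y$ is the recursive join). $G(\gamma,\delta)\simeq i$ means that this computation converges with output $i$. -}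

module Defs where

open import Axiom.ExcludedMiddle using (ExcludedMiddle)
open import Data.Bool using (Bool; true; false; if_then_else_)
open import Data.List using (List; []; _∷_; length; map; replicate; takeWhileᵇ)
open import Data.Nat using (ℕ; zero; suc; _+_; _≡ᵇ_; _/_; _%_; _≤_; z≤n; s≤s)
open import Data.Nat.Properties using (+-identityʳ; +-suc; m≤n+m; ≤-trans; ≤-refl)
open import Data.Product using (_×_; _,_; ∃; ∃-syntax)
open import Data.Sum using (_⊎_; inj₁; inj₂)
open import Function using (id)
open import Induction.WellFounded using (Acc; acc; WellFounded)
open import Level using (0ℓ)
open import Relation.Binary.Construct.Closure.ReflexiveTransitive using (Star)
open import Relation.Binary.PropositionalEquality using (_≡_; refl; cong; sym; trans)
open import Relation.Nullary using (¬_; yes; no; contradiction)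
open import Relation.Nullary.Construct.Add.Supremum using (_⁺; [_]) renaming (⊤⁺ to ω₁) public

------------------------------------------------------------------------
-- Coding finite sequences of integers by integers

-- unpair enumerates ℕ × ℕ along the anti-diagonals; pair is its inverse.
next-pair : ℕ × ℕ → ℕ × ℕ
next-pair (zero  , b) = suc b , zero
next-pair (suc a , b) = a , suc b

unpair : ℕ → ℕ × ℕ
unpair zero    = zero , zero
unpair (suc n) = next-pair (unpair n)

triangle : ℕ → ℕ
triangle zero    = zero
triangle (suc n) = suc (triangle n + n)

pair : ℕ → ℕ → ℕ
pair a b = triangle (a + b) + b

encode : List ℕ → ℕ
encode []       = zero
encode (x ∷ xs) = suc (pair x (encode xs))

-- Every element of a nonempty sequence, and the code of its tail, is smaller
-- than the code of the sequence, so a number is enough fuel to decode itself.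
decode-fuel : ℕ → ℕ → List ℕ
decode-fuel _       zero    = []
decode-fuel zero    (suc _) = []
decode-fuel (suc f) (suc n) with unpair n
... | x , rest = x ∷ decode-fuel f rest

decode : ℕ → List ℕ
decode n = decode-fuel n n

unpair-diagonal : ∀ s b a → a + b ≡ s → unpair (triangle s + b) ≡ (a , b)
unpair-diagonal zero    zero    zero    _    = refl
unpair-diagonal (suc s) zero    a       eq
  rewrite +-identityʳ (triangle s + s) | unpair-diagonal s s zero refl
        | +-identityʳ a | eq = refl
unpair-diagonal s       (suc b) a       eq
  rewrite +-suc (triangle s) b
        | unpair-diagonal s b (suc a) (trans (sym (+-suc a b)) eq) = refl

unpair-pair : ∀ a b → unpair (pair a b) ≡ (a , b)
unpair-pair a b = unpair-diagonal (a + b) b a refl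

decode-fuel-encode : ∀ f xs → encode xs ≤ f → decode-fuel f (encode xs) ≡ xs
decode-fuel-encode zero    []       _       = refl
decode-fuel-encode (suc f) []       _       = refl
decode-fuel-encode (suc f) (x ∷ xs) (s≤s p)
  rewrite unpair-pair x (encode xs) =
  cong (x ∷_) (decode-fuel-encode f xs (≤-trans (m≤n+m _ (triangle (x + encode xs))) p))

decode-encode : ∀ xs → decode (encode xs) ≡ xs
decode-encode xs = decode-fuel-encode (encode xs) xs ≤-refl

------------------------------------------------------------------------
-- Oracle Turing machine programs with a feedback query

Oracle : Set
Oracle = ℕ → Bool

_⊕_ : Oracle → Oracle → Oracle
(X ⊕ Y) n = if n % 2 ≡ᵇ 0 then X (n / 2) else Y (n / 2)

-- Tapes are infinite in both directions, with symbols true (a stroke) and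
-- false (blank).  The second list starts with the scanned square, the first
-- runs leftwards from it; squares outside the lists are blank.
Tape : Set
Tape = List Bool × List Bool

scan : Tape → Bool
scan (l , [])    = false
scan (l , b ∷ r) = b

write : Bool → Tape → Tape
write b (l , [])    = l , b ∷ []
write b (l , _ ∷ r) = l , b ∷ r

moveLeft : Tape → Tape
moveLeft ([]    , r) = [] , false ∷ r
moveLeft (b ∷ l , r) = l , b ∷ r

moveRight : Tape → Tape
moveRight (l , [])    = false ∷ l , []
moveRight (l , b ∷ r) = b ∷ l , r

-- Integers are written in unary, starting from the scanned square.
numeral : ℕ → Tape
numeral n = [] , replicate n true

value : Tape → ℕ
value (_ , r) = length (takeWhileᵇ id r)

-- Machines are multi-tape.  The first arguments of an instruction are tapes,
-- the arguments written p q are positions in the program (the states of the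
-- machine) to continue at.  Instructions without p q continue at the next
-- position.
data Instr : Set where
  left right mark erase : ℕ → Instr
  branch : (t p q : ℕ) → Instr     -- p if the scanned symbol on t is a stroke
  oracle : (t p q : ℕ) → Instr     -- p if X (value of t) is true
  query  : (t u p q : ℕ) → Instr   -- p if ⟨value of t⟩^X (value of u) converges
  halt   : Instr

Program : Set
Program = List Instr

encodeInstr : Instr → List ℕ
encodeInstr (left t)        = 0 ∷ t ∷ []
encodeInstr (right t)       = 1 ∷ t ∷ []
encodeInstr (mark t)        = 2 ∷ t ∷ []
encodeInstr (erase t)       = 3 ∷ t ∷ []
encodeInstr (branch t p q)  = 4 ∷ t ∷ p ∷ q ∷ []
encodeInstr (oracle t p q)  = 5 ∷ t ∷ p ∷ q ∷ []
encodeInstr (query t u p q) = 6 ∷ t ∷ u ∷ p ∷ q ∷ []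
encodeInstr halt            = []

decodeInstr : List ℕ → Instr
decodeInstr (0 ∷ t ∷ [])             = left t
decodeInstr (1 ∷ t ∷ [])             = right t
decodeInstr (2 ∷ t ∷ [])             = mark t
decodeInstr (3 ∷ t ∷ [])             = erase t
decodeInstr (4 ∷ t ∷ p ∷ q ∷ [])     = branch t p q
decodeInstr (5 ∷ t ∷ p ∷ q ∷ [])     = oracle t p q
decodeInstr (6 ∷ t ∷ u ∷ p ∷ q ∷ []) = query t u p q
decodeInstr _                        = halt

index : Program → ℕ
index P = encode (map (λ i → encode (encodeInstr i)) P)

program : ℕ → Program
program e = map (λ n → decodeInstr (decode n)) (decode e)

decodeInstr-encodeInstr : ∀ i → decodeInstr (encodeInstr i) ≡ i
decodeInstr-encodeInstr (left t)        = refl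
decodeInstr-encodeInstr (right t)       = refl
decodeInstr-encodeInstr (mark t)        = refl
decodeInstr-encodeInstr (erase t)       = refl
decodeInstr-encodeInstr (branch t p q)  = refl
decodeInstr-encodeInstr (oracle t p q)  = refl
decodeInstr-encodeInstr (query t u p q) = refl
decodeInstr-encodeInstr halt            = refl

program-index : ∀ P → program (index P) ≡ P
program-index P
  rewrite decode-encode (map (λ i → encode (encodeInstr i)) P) = go P
  where
  go : ∀ P → map (λ n → decodeInstr (decode n)) (map (λ i → encode (encodeInstr i)) P) ≡ P
  go []      = refl
  go (i ∷ P) rewrite decode-encode (encodeInstr i) | decodeInstr-encodeInstr i =
    cong (i ∷_) (go P)

-- Positions beyond the end of the program hold halt.
fetch : Program → ℕ → Instr
fetch []      _       = halt
fetch (i ∷ P) zero    = i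
fetch (i ∷ P) (suc p) = fetch P p

Tapes : Set
Tapes = ℕ → Tape

_[_≔_] : Tapes → ℕ → Tape → Tapes
(T [ t ≔ x ]) s = if s ≡ᵇ t then x else T s

Config : Set
Config = ℕ × Tapes

start : ℕ → Config
start m = 0 , (λ _ → [] , []) [ 0 ≔ numeral m ]

data Answer : Set where
  converges diverges : Answer

data Action : Set where
  next : Config → Action
  ask  : (e m : ℕ) → (Answer → Config) → Action
  stop : (output : ℕ) → Action

action : Program → Oracle → Config → Action
action P X (p , T) with fetch P p
... | left t         = next (suc p , T [ t ≔ moveLeft (T t) ])
... | right t        = next (suc p , T [ t ≔ moveRight (T t) ])
... | mark t         = next (suc p , T [ t ≔ write true (T t) ])
... | erase t        = next (suc p , T [ t ≔ write false (T t) ])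
... | branch t p′ q′ = next ((if scan (T t) then p′ else q′) , T)
... | oracle t p′ q′ = next ((if X (value (T t)) then p′ else q′) , T)
... | query t u p′ q′ = ask (value (T t)) (value (T u)) λ where
  converges → p′ , T
  diverges  → q′ , T
... | halt           = stop (value (T 0))

------------------------------------------------------------------------
-- Feedback computation

Computation : Set
Computation = ℕ × ℕ × Oracle

-- ↓ k and ↑ stand for the pairs ⟨↓, k⟩ and ⟨↑, ω⟩.
data Outcome : Set where
  ↓_ : ℕ → Outcome
  ↑  : Outcome

answer : Outcome → Answer
answer (↓ _) = converges
answer ↑     = diverges

-- The graph of a partial function from computations to outcomes.
Graph : Set₁
Graph = Computation → Outcome → Set

data Step (C : Graph) (P : Program) (X : Oracle) (c : Config) : Config → Set where
  compute : ∀ {c′} → action P X c ≡ next c′ → Step C P X c c′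
  feed    : ∀ {e m κ o} → action P X c ≡ ask e m κ → C (e , m , X) o →
            Step C P X c (κ (answer o))

data Γ (C : Graph) : Computation → Outcome → Set where
  halts : ∀ {e m X k c} →
          Star (Step C (program e) X) (start m) c →
          action (program e) X c ≡ stop k →
          Γ C (e , m , X) (↓ k)
  runs-forever : ∀ {e m X} (c : ℕ → Config) →
          c 0 ≡ start m →
          (∀ n → Step C (program e) X (c n) (c (suc n))) →
          Γ C (e , m , X) ↑

data I∞ : Graph where
  fix : ∀ {γ o} → Γ I∞ γ o → I∞ γ o

⟨_⟩^_[_]≃_ : ℕ → Oracle → ℕ → ℕ → Set
⟨ e ⟩^ X [ m ]≃ k = I∞ (e , m , X) (↓ k)

------------------------------------------------------------------------
-- Countable ordinals

-- sup⁺ f is the least ordinal strictly above every f i.  Distinct trees may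
-- denote the same ordinal: equality of ordinals is ≤ᵒ in both directions.
data Ord : Set where
  zero : Ord
  sup⁺ : (ℕ → Ord) → Ord

infix 4 _≤ᵒ_ _<ᵒ_

mutual
  data _≤ᵒ_ : Ord → Ord → Set where
    z≤   : ∀ {β} → zero ≤ᵒ β
    sup≤ : ∀ {f β} → (∀ i → f i <ᵒ β) → sup⁺ f ≤ᵒ β

  data _<ᵒ_ : Ord → Ord → Set where
    <sup : ∀ {α f} i → α ≤ᵒ f i → α <ᵒ sup⁺ f

open import Relation.Binary.Construct.Add.Supremum.NonStrict _≤ᵒ_ public using (_≤⁺_; [_]; _≤⊤⁺)
open import Relation.Binary.Construct.Add.Supremum.Strict _<ᵒ_ public using (_<⁺_; [_]; [_]<⊤⁺)

<ᵒ-≤ᵒ-trans : ∀ {α β γ} → α <ᵒ β → β ≤ᵒ γ → α <ᵒ γ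
≤ᵒ-<ᵒ-trans : ∀ {α β γ} → α ≤ᵒ β → β <ᵒ γ → α <ᵒ γ
≤ᵒ-trans    : ∀ {α β γ} → α ≤ᵒ β → β ≤ᵒ γ → α ≤ᵒ γ
<ᵒ-≤ᵒ-trans (<sup i α≤) (sup≤ f<) = ≤ᵒ-<ᵒ-trans α≤ (f< i)
≤ᵒ-<ᵒ-trans α≤β (<sup i β≤) = <sup i (≤ᵒ-trans α≤β β≤)
≤ᵒ-trans z≤        β≤γ = z≤
≤ᵒ-trans (sup≤ f<) β≤γ = sup≤ λ i → <ᵒ-≤ᵒ-trans (f< i) β≤γ

<ᵒ-wellFounded : WellFounded _<ᵒ_
<ᵒ-wellFounded α = acc (below α)
  where
  below : ∀ α {β} → β <ᵒ α → Acc _<ᵒ_ β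
  below (sup⁺ f) (<sup i β≤) = acc λ γ<β → below (f i) (<ᵒ-≤ᵒ-trans γ<β β≤)

≤ᵒ-or-> : ExcludedMiddle 0ℓ → ∀ α β → α ≤ᵒ β ⊎ β <ᵒ α
≤ᵒ-or-> em zero     β = inj₁ z≤
≤ᵒ-or-> em (sup⁺ f) β with em {∃[ i ] β ≤ᵒ f i}
... | yes (i , β≤) = inj₂ (<sup i β≤)
... | no ¬β≤       = inj₁ (sup≤ λ i → smaller i (≤ᵒ-or-> em β (f i)))
  where
  smaller : ∀ i → β ≤ᵒ f i ⊎ f i <ᵒ β → f i <ᵒ β
  smaller i (inj₁ β≤) = contradiction (i , β≤) ¬β≤
  smaller i (inj₂ f<) = f<

------------------------------------------------------------------------
-- Rank

-- I α is Γ applied to the union of the I β with β < α.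
data I : Ord → Graph where
  stage : ∀ {α γ o} → Γ (λ γ′ o′ → ∃[ β ] (β <ᵒ α × I β γ′ o′)) γ o → I α γ o

-- Rank γ r says that ρ(γ) = r.  A relation is used because a choice of rank
-- needs excluded middle and is unique only up to equality of ordinals.
data Rank (γ : Computation) : Ord ⁺ → Set where
  defined   : ∀ {α} → ∃[ o ] I α γ o → (∀ β → ∃[ o ] I β γ o → α ≤ᵒ β) → Rank γ [ α ]
  undefined : (∀ α → ¬ (∃[ o ] I α γ o)) → Rank γ ω₁

rank-exists : ExcludedMiddle 0ℓ → ∀ γ → ∃ (Rank γ)
rank-exists em γ with em {∃[ α ] ∃[ o ] I α γ o}
... | no ¬I        = ω₁ , undefined λ α I → ¬I (α , I)
... | yes (α , Iα) = least α Iα (<ᵒ-wellFounded α)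
  where
  least : ∀ α → ∃[ o ] I α γ o → Acc _<ᵒ_ α → ∃ (Rank γ)
  least α Iα (acc rs) with em {∃[ β ] (β <ᵒ α × ∃[ o ] I β γ o)}
  ... | yes (β , β<α , Iβ) = least β Iβ (rs β<α)
  ... | no ¬smaller = [ α ] , defined Iα λ β Iβ → minimal β Iβ (≤ᵒ-or-> em α β)
    where
    minimal : ∀ β → ∃[ o ] I β γ o → α ≤ᵒ β ⊎ β <ᵒ α → α ≤ᵒ β
    minimal β Iβ (inj₁ α≤β) = α≤β
    minimal β Iβ (inj₂ β<α) = contradiction (β , β<α , Iβ) ¬smaller

{-# OPTIONS --safe #-}

-- U simulates a computation.  W(ξ, η) simulates ξ too, but before a query ξ′ of ξ
-- is answered it asks whether W(η, ξ′) converges: if so, it answers ξ′ by asking U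
-- and continues, and if not, it halts; when ξ halts, W runs forever.  Whenever the
-- smaller rank is defined, W(ξ, η) diverges if ρ(ξ) ≤ ρ(η) and converges if
-- ρ(η) < ρ(ξ).  Indeed ρ(ξ) ≤ ρ(η) iff every query ξ′ of ξ has ρ(ξ′) < ρ(η), that
-- is, iff all the W(η, ξ′) converge.  The induction is on the smaller rank, the
-- divergent case at a rank being used for the convergent case at the same rank.
-- Nothing undefined is ever asked, because a computation of large or undefined
-- rank reaches a query of large rank, at which W halts before asking U.
module Submission where

open import Defs
open import Axiom.ExcludedMiddle using (ExcludedMiddle)
open import Data.Bool using (Bool; true; false; if_then_else_; not)
open import Data.Bool.Properties using (not-involutive)
open import Data.Fin using (Fin; zero; suc; #_)
open import Data.List using (List; []; _∷_; drop; length; map; replicate; takeWhileᵇ)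
open import Data.Nat using (ℕ; zero; suc; pred; _+_; _*_; _≡ᵇ_; _/_; _%_; _≤_; _<_; z≤n; s≤s)
open import Data.Nat.Divisibility using (divides)
open import Data.Nat.DivMod using (m*n%n≡0; m*n/n≡m; [m+kn]%n≡m%n; +-distrib-/-∣ʳ)
open import Data.Nat.Properties using
  ( _≟_; *-comm; +-identityʳ; +-suc; 1+n≢n; <⇒≢; >⇒≢; <-≤-trans; ≤-refl; ≤-trans
  ; m≤n+m; m≤n⇒m≤1+n; m≤n⇒m≤o+n )
open import Data.Product using (_×_; _,_; ∃; ∃-syntax; proj₁; proj₂)
open import Data.Unit using (⊤; tt)
open import Data.Vec as Vec using (Vec; []; _∷_; lookup)
open import Data.Vec.Properties using (lookup-map)
open import Data.Vec.Relation.Unary.All as All using (All; []; _∷_)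
open import Data.Vec.Relation.Unary.All.Properties using (lookup⁺)
open import Function using (id; _∘_)
open import Induction.WellFounded using (Acc; acc)
open import Level using (0ℓ)
open import Relation.Binary.Construct.Closure.ReflexiveTransitive using (Star; ε; _◅_; _◅◅_)
open import Relation.Binary.PropositionalEquality
  using (_≡_; _≢_; refl; sym; trans; cong; cong₂; subst; subst₂; ≢-sym)
open import Relation.Nullary using (¬_; yes; no; contradiction)

-- While programs over counters

-- A query reports only convergence or divergence, and which verdict of `W` converges is forced. A
-- query of `ξ` whose rank is not below `ρ(η)` turns up after finitely many steps, so it can be
-- announced by halting. That every query is below may concern an infinite run and can only be
-- announced by running forever; for uniformity a halting `ξ` then has to end in an endless loop.
-- Ranks are never computed. The induction places an ordinal `α` between the two ranks and speaks
-- only of bounds `ρ(γ) ≤ α` and their negations, so an undefined rank on the larger side needs no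
-- separate treatment. The index in the theorem must belong to an actual machine, whence the bulk of
-- the development: while programs over unary counters, primitive recursive functions compiled to
-- them, and machines that iterate one such function on a single number and act on its value. `U`
-- and `W` are one such machine in different modes; `G` is another, whose only query is to `W`.

≡ᵇ-refl : ∀ n → (n ≡ᵇ n) ≡ true
≡ᵇ-refl zero    = refl
≡ᵇ-refl (suc n) = ≡ᵇ-refl n

≢⇒≡ᵇ : ∀ {m n} → m ≢ n → (m ≡ᵇ n) ≡ false
≢⇒≡ᵇ {zero}  {zero}  m≢n = contradiction refl m≢n
≢⇒≡ᵇ {zero}  {suc n} m≢n = refl
≢⇒≡ᵇ {suc m} {zero}  m≢n = refl
≢⇒≡ᵇ {suc m} {suc n} m≢n = ≢⇒≡ᵇ λ m≡n → m≢n (cong suc m≡n)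

State : Set
State = ℕ → ℕ

_[_↦_] : State → ℕ → ℕ → State
(σ [ r ↦ v ]) x = if x ≡ᵇ r then v else σ x

↦-same : ∀ σ r v → (σ [ r ↦ v ]) r ≡ v
↦-same σ r v rewrite ≡ᵇ-refl r = refl

↦-other : ∀ σ r v {x} → x ≢ r → (σ [ r ↦ v ]) x ≡ σ x
↦-other σ r v x≢r rewrite ≢⇒≡ᵇ x≢r = refl

positive : ℕ → Bool
positive zero    = false
positive (suc _) = true

isConvergent : Outcome → Bool
isConvergent (↓ _) = true
isConvergent ↑     = false

data Test : Set where
  nonzero member : ℕ → Test
  converging     : ℕ → ℕ → Test

data Cmd : Set where
  skip    : Cmd
  inc dec : ℕ → Cmd
  _⨾_     : Cmd → Cmd → Cmd
  test    : Test → Cmd → Cmd → Cmd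
  while   : ℕ → Cmd → Cmd

infixr 5 _⨾_

testInstr : Test → ℕ → ℕ → Instr
testInstr (nonzero r)      p q = branch r p q
testInstr (member r)       p q = oracle r p q
testInstr (converging r s) p q = query r s p q

-- The length of the code depends on the command alone, so forward jump targets are known before
-- anything is assembled.
end : Cmd → ℕ → ℕ
end skip         p = p
end (inc r)      p = 2 + p
end (dec r)      p = 1 + p
end (c ⨾ d)      p = end d (end c p)
end (test t c d) p = end d (1 + end c (1 + p))
end (while r c)  p = 1 + end c (1 + p)

-- The code of a command, loaded at a position and followed by given code.
assemble : Cmd → ℕ → Program → Program
assemble skip         p Q = Q
assemble (inc r)      p Q = left r ∷ mark r ∷ Q
assemble (dec r)      p Q = right r ∷ Q
assemble (c ⨾ d)      p Q = assemble c p (assemble d (end c p) Q)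
assemble (test t c d) p Q =
  testInstr t (1 + p) (1 + end c (1 + p)) ∷ assemble c (1 + p)
    (branch 0 (end (test t c d) p) (end (test t c d) p) ∷ assemble d (1 + end c (1 + p)) Q)
assemble (while r c)  p Q =
  branch r (1 + p) (end (while r c) p) ∷ assemble c (1 + p) (branch 0 p p ∷ Q)

At : Program → ℕ → Program → Set
At P p []       = ⊤
At P p (i ∷ is) = fetch P p ≡ i × At P (suc p) is

At-self : ∀ P → At P 0 P
At-self []      = tt
At-self (i ∷ P) = refl , shift P (At-self P)
  where
  shift : ∀ {p} Q → At P p Q → At (i ∷ P) (suc p) Q
  shift []      _         = tt
  shift (j ∷ Q) (eq , at) = eq , shift Q at

Loaded : Program → ℕ → Cmd → Set
Loaded P p skip         = ⊤
Loaded P p (inc r)      = fetch P p ≡ left r × fetch P (1 + p) ≡ mark r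
Loaded P p (dec r)      = fetch P p ≡ right r
Loaded P p (c ⨾ d)      = Loaded P p c × Loaded P (end c p) d
Loaded P p (test t c d) =
  fetch P p ≡ testInstr t (1 + p) (1 + end c (1 + p)) × Loaded P (1 + p) c
  × fetch P (end c (1 + p)) ≡ branch 0 (end (test t c d) p) (end (test t c d) p)
  × Loaded P (1 + end c (1 + p)) d
Loaded P p (while r c)  =
  fetch P p ≡ branch r (1 + p) (end (while r c) p) × Loaded P (1 + p) c
  × fetch P (end c (1 + p)) ≡ branch 0 p p

assemble-loaded : ∀ {P} c {p} Q → At P p (assemble c p Q) → Loaded P p c × At P (end c p) Q
assemble-loaded skip         Q at = tt , at
assemble-loaded (inc r)      Q (eq₁ , eq₂ , at) = (eq₁ , eq₂) , at
assemble-loaded (dec r)      Q at = at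
assemble-loaded (c ⨾ d)      Q at =
  let ld₁ , at₁ = assemble-loaded c _ at
      ld₂ , at₂ = assemble-loaded d Q at₁
  in (ld₁ , ld₂) , at₂
assemble-loaded (test t c d) Q (eq₁ , at) =
  let ld₁ , eq₂ , at₁ = assemble-loaded c _ at
      ld₂ , at₂ = assemble-loaded d Q at₁
  in (eq₁ , ld₁ , eq₂ , ld₂) , at₂
assemble-loaded (while r c)  Q (eq₁ , at) =
  let ld , eq₂ , at₁ = assemble-loaded c _ at
  in (eq₁ , ld , eq₂) , at₁

-- A square left of the scanned one may hold anything, so that moving right
-- decrements a counter (and fixes 0) and moving left and marking increments it.
_∼_ : Tapes → State → Set
T ∼ σ = ∀ r → ∃[ l ] T r ≡ (l , replicate (σ r) true)

≔-∼ : ∀ {T σ r l v} → T ∼ σ → (T [ r ≔ (l , replicate v true) ]) ∼ (σ [ r ↦ v ])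
≔-∼ {r = r} T∼σ x with x ≡ᵇ r
... | true  = _ , refl
... | false = T∼σ x

-- Incrementing assigns to one tape twice. After the move the scanned square may still be blank, so
-- the tapes in between need not represent a state; only the last assignment counts.
≔-≔-∼ : ∀ {T σ r x y l v} → T ∼ σ → y ≡ (l , replicate v true) → ((T [ r ≔ x ]) [ r ≔ y ]) ∼ (σ [ r ↦ v ])
≔-≔-∼ {r = r} T∼σ refl s with s ≡ᵇ r
... | true  = _ , refl
... | false = T∼σ s

≔-same : ∀ T r y → (T [ r ≔ y ]) r ≡ y
≔-same T r y rewrite ≡ᵇ-refl r = refl

value-numeral : ∀ l n → value (l , replicate n true) ≡ n
value-numeral l zero    = refl
value-numeral l (suc n) = cong suc (value-numeral l n)

scan-numeral : ∀ l n → scan (l , replicate n true) ≡ positive n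
scan-numeral l zero    = refl
scan-numeral l (suc n) = refl

left-mark : ∀ l n → ∃[ l′ ] write true (moveLeft (l , replicate n true)) ≡ (l′ , replicate (suc n) true)
left-mark []      n = _ , refl
left-mark (b ∷ l) n = _ , refl

right-pred : ∀ l n → ∃[ l′ ] moveRight (l , replicate n true) ≡ (l′ , replicate (pred n) true)
right-pred l zero    = _ , refl
right-pred l (suc n) = _ , refl

module _ (C : Graph) (Z : Oracle) where

  Holds : Test → State → Bool → Set
  Holds (nonzero r)      σ b = positive (σ r) ≡ b
  Holds (member r)       σ b = Z (σ r) ≡ b
  Holds (converging r s) σ b = ∃[ o ] C (σ r , σ s , Z) o × isConvergent o ≡ b

  -- Only terminating executions are described. Endless runs arise solely from the outermost loop of
  -- a machine and are put together from terminating passes through its body.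
  data Exec : Cmd → State → State → Set where
    skip  : ∀ {σ} → Exec skip σ σ
    inc   : ∀ {σ r} → Exec (inc r) σ (σ [ r ↦ suc (σ r) ])
    dec   : ∀ {σ r} → Exec (dec r) σ (σ [ r ↦ pred (σ r) ])
    _⨾_   : ∀ {σ τ υ c d} → Exec c σ τ → Exec d τ υ → Exec (c ⨾ d) σ υ
    test  : ∀ {σ τ t c d} b → Holds t σ b → Exec (if b then c else d) σ τ → Exec (test t c d) σ τ
    done  : ∀ {σ r c} → σ r ≡ 0 → Exec (while r c) σ σ
    again : ∀ {σ τ υ r c} → positive (σ r) ≡ true → Exec c σ τ → Exec (while r c) τ υ →
            Exec (while r c) σ υ

module _ {C : Graph} {Z : Oracle} {P : Program} where

  private
    Steps : Config → Config → Set
    Steps = Star (Step C P Z)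

  -- With two equal targets `branch` serves as an unconditional jump, whatever is scanned.
  jump : ∀ {p T t q} → fetch P p ≡ branch t q q → Step C P Z (p , T) (q , T)
  jump {p} {T} {t} {q} eq = compute (lemma (scan (T t)) refl)
    where
    lemma : ∀ b → scan (T t) ≡ b → action P Z (p , T) ≡ next (q , T)
    lemma true  sc rewrite eq | sc = refl
    lemma false sc rewrite eq | sc = refl

  testStep : ∀ {p T σ} t {x y} b → T ∼ σ → fetch P p ≡ testInstr t x y → Holds C Z t σ b →
             Step C P Z (p , T) ((if b then x else y) , T)
  testStep {p} {T} {σ} (nonzero r) {x} {y} b T∼σ eq refl = compute lemma
    where
    lemma : action P Z (p , T) ≡ next ((if positive (σ r) then x else y) , T)
    lemma rewrite eq | proj₂ (T∼σ r) | scan-numeral (proj₁ (T∼σ r)) (σ r) = refl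
  testStep {p} {T} {σ} (member r) {x} {y} b T∼σ eq refl = compute lemma
    where
    lemma : action P Z (p , T) ≡ next ((if Z (σ r) then x else y) , T)
    lemma rewrite eq | proj₂ (T∼σ r) | value-numeral (proj₁ (T∼σ r)) (σ r) = refl
  testStep {p} {T} {σ} (converging r s) {x} {y} b T∼σ eq (o , Co , refl) =
    let κ , asks , conv , div = lemma
    in subst (Step C P Z (p , T)) (result o {κ} conv div) (feed asks Co)
    where
    -- The continuation is an anonymous function of the answer, so it is characterised by its two
    -- values.
    lemma : ∃[ κ ] action P Z (p , T) ≡ ask (σ r) (σ s) κ × κ converges ≡ (x , T) × κ diverges ≡ (y , T)
    lemma rewrite eq | proj₂ (T∼σ r) | value-numeral (proj₁ (T∼σ r)) (σ r)
                | proj₂ (T∼σ s) | value-numeral (proj₁ (T∼σ s)) (σ s) = _ , refl , refl , refl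
    result : ∀ o {κ : Answer → Config} → κ converges ≡ (x , T) → κ diverges ≡ (y , T) →
             κ (answer o) ≡ ((if isConvergent o then x else y) , T)
    result (↓ _) conv div = conv
    result ↑     conv div = div

  Exec⇒Steps : ∀ {c σ τ p T} → Exec C Z c σ τ → Loaded P p c → T ∼ σ →
               ∃[ T′ ] T′ ∼ τ × Steps (p , T) (end c p , T′)
  Exec⇒Steps skip ld T∼σ = _ , T∼σ , ε
  Exec⇒Steps {inc r} {σ} {p = p} {T} inc (eq₁ , eq₂) T∼σ =
    _ , ≔-≔-∼ {x = moveLeft (T r)} T∼σ marked , compute moves ◅ compute marks ◅ ε
    where
    moves : action P Z (p , T) ≡ next (suc p , T [ r ≔ moveLeft (T r) ])
    moves rewrite eq₁ = refl
    T₁ : Tapes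
    T₁ = T [ r ≔ moveLeft (T r) ]
    marks : action P Z (suc p , T₁) ≡ next (2 + p , T₁ [ r ≔ write true (T₁ r) ])
    marks rewrite eq₂ = refl
    marked : write true (T₁ r) ≡ (proj₁ (left-mark (proj₁ (T∼σ r)) (σ r)) , replicate (suc (σ r)) true)
    marked = trans (cong (write true) (trans (≔-same T r _) (cong moveLeft (proj₂ (T∼σ r)))))
                   (proj₂ (left-mark _ (σ r)))
  Exec⇒Steps {dec r} {σ} {p = p} {T} dec eq T∼σ = _ , holds , compute moves ◅ ε
    where
    moves : action P Z (p , T) ≡ next (suc p , T [ r ≔ moveRight (T r) ])
    moves rewrite eq = refl
    moved : moveRight (T r) ≡ (proj₁ (right-pred (proj₁ (T∼σ r)) (σ r)) , replicate (pred (σ r)) true)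
    moved = trans (cong moveRight (proj₂ (T∼σ r))) (proj₂ (right-pred _ (σ r)))
    holds : (T [ r ≔ moveRight (T r) ]) ∼ (σ [ r ↦ pred (σ r) ])
    holds rewrite moved = ≔-∼ T∼σ
  Exec⇒Steps (c ⨾ d) (ld₁ , ld₂) T∼σ =
    let T₁ , T₁∼ , steps₁ = Exec⇒Steps c ld₁ T∼σ
        T₂ , T₂∼ , steps₂ = Exec⇒Steps d ld₂ T₁∼
    in T₂ , T₂∼ , steps₁ ◅◅ steps₂
  Exec⇒Steps (test {t = t} true h c) (eq₁ , ld₁ , eq₂ , ld₂) T∼σ =
    let T₁ , T₁∼ , steps = Exec⇒Steps c ld₁ T∼σ
    in T₁ , T₁∼ , testStep t true T∼σ eq₁ h ◅ steps ◅◅ jump eq₂ ◅ ε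
  Exec⇒Steps (test {t = t} false h d) (eq₁ , ld₁ , eq₂ , ld₂) T∼σ =
    let T₁ , T₁∼ , steps = Exec⇒Steps d ld₂ T∼σ
    in T₁ , T₁∼ , testStep t false T∼σ eq₁ h ◅ steps
  Exec⇒Steps {while r c} (done σr≡0) (eq₁ , _) T∼σ =
    _ , T∼σ , testStep (nonzero r) false T∼σ eq₁ (cong positive σr≡0) ◅ ε
  Exec⇒Steps {while r c} (again pos ex exs) ld@(eq₁ , ld₁ , eq₂) T∼σ =
    let T₁ , T₁∼ , steps₁ = Exec⇒Steps ex ld₁ T∼σ
        T₂ , T₂∼ , steps₂ = Exec⇒Steps exs ld T₁∼
    in T₂ , T₂∼ , testStep (nonzero r) true T∼σ eq₁ pos ◅ steps₁ ◅◅ jump eq₂ ◅ steps₂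

-- Primitive recursive functions

-- Iteration carries two values and returns the first. A pair is needed before pairing is available:
-- the projections of `unpair` are themselves programmed by such an iteration, and a round counter
-- can be kept as the second value.
data Fn (n : ℕ) : Set where
  var  : Fin n → Fn n
  zer  : Fn n
  sucF : Fn n → Fn n
  preF : Fn n → Fn n
  ifz  : Fn n → Fn n → Fn n → Fn n
  iter : (count init₁ init₂ : Fn n) (step₁ step₂ : Fn (2 + n)) → Fn n
  call : ∀ {k} → Fn k → Vec (Fn n) k → Fn n

ifZero : ℕ → ℕ → ℕ → ℕ
ifZero zero    x y = x
ifZero (suc _) x y = y

-- Accumulating form, as a counter loop executes it; `loop-suc` brings the last round to the
-- outside.
loop : ∀ {a} {A : Set a} → (A → A) → ℕ → A → A
loop f zero    x = x
loop f (suc n) x = loop f n (f x)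

mutual
  ⟦_⟧ : ∀ {n} → Fn n → Vec ℕ n → ℕ
  ⟦ var i ⟧            ρ = lookup ρ i
  ⟦ zer ⟧              ρ = 0
  ⟦ sucF e ⟧           ρ = suc (⟦ e ⟧ ρ)
  ⟦ preF e ⟧           ρ = pred (⟦ e ⟧ ρ)
  ⟦ ifz c d e ⟧        ρ = ifZero (⟦ c ⟧ ρ) (⟦ d ⟧ ρ) (⟦ e ⟧ ρ)
  ⟦ iter c d e f₁ f₂ ⟧ ρ =
    proj₁ (loop (λ (a , b) → ⟦ f₁ ⟧ (a ∷ b ∷ ρ) , ⟦ f₂ ⟧ (a ∷ b ∷ ρ)) (⟦ c ⟧ ρ) (⟦ d ⟧ ρ , ⟦ e ⟧ ρ))
  ⟦ call g es ⟧        ρ = ⟦ g ⟧ (⟦ es ⟧* ρ)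

  ⟦_⟧* : ∀ {n k} → Vec (Fn n) k → Vec ℕ n → Vec ℕ k
  ⟦ [] ⟧*     ρ = []
  ⟦ e ∷ es ⟧* ρ = ⟦ e ⟧ ρ ∷ ⟦ es ⟧* ρ

-- Compiling primitive recursive functions to counter programs

clear : ℕ → Cmd
clear r = while r (dec r)

shift : ℕ → ℕ → Cmd
shift a b = while a (dec a ⨾ inc b)

split : ℕ → ℕ → ℕ → Cmd
split a b c = while a (dec a ⨾ inc b ⨾ inc c)

move : ℕ → ℕ → Cmd
move a b = clear b ⨾ shift a b

-- A counter can be read off only by emptying it, so two copies are made and one of them is moved
-- back.
copy : ℕ → ℕ → ℕ → Cmd
copy a b c = clear b ⨾ clear c ⨾ split a b c ⨾ shift c a

from : ∀ k → ℕ → Vec ℕ k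
from zero    f = []
from (suc k) f = f ∷ from k (suc f)

-- compile e vs f leaves in f the value of e at the contents of vs, using f and
-- the counters above it as scratch.
mutual
  compile : ∀ {n} → Fn n → Vec ℕ n → ℕ → Cmd
  compile (var i)            vs f = copy (lookup vs i) f (suc f)
  compile zer                vs f = clear f
  compile (sucF e)           vs f = compile e vs f ⨾ inc f
  compile (preF e)           vs f = compile e vs f ⨾ dec f
  compile (ifz c d e)        vs f = compile c vs f ⨾ test (nonzero f) (compile e vs f) (compile d vs f)
  compile (iter c d e f₁ f₂) vs f =
    compile d vs f ⨾ compile e vs (1 + f) ⨾ compile c vs (2 + f) ⨾ while (2 + f) (iterBody f₁ f₂ vs f)
  compile (call {k} g es)    vs f = compile* es vs f ⨾ compile g (from k f) (k + f) ⨾ fetchResult k f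

  -- The pair is in `f` and `1 + f`, the number of remaining rounds in `2 + f`. Both new values are
  -- computed higher up before either old one is overwritten, since each step function reads both.
  iterBody : ∀ {n} (f₁ f₂ : Fn (2 + n)) → Vec ℕ n → ℕ → Cmd
  iterBody f₁ f₂ vs f =
    dec (2 + f) ⨾ compile f₁ (f ∷ 1 + f ∷ vs) (3 + f) ⨾ compile f₂ (f ∷ 1 + f ∷ vs) (4 + f)
    ⨾ move (3 + f) f ⨾ move (4 + f) (1 + f)

  fetchResult : ℕ → ℕ → Cmd
  -- Without arguments the result is already in place, and moving a counter onto itself would clear
  -- it.
  fetchResult zero    f = skip
  fetchResult (suc k) f = move (suc k + f) f

  compile* : ∀ {n k} → Vec (Fn n) k → Vec ℕ n → ℕ → Cmd
  compile* []       vs f = skip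
  compile* (e ∷ es) vs f = compile e vs f ⨾ compile* es vs (suc f)

module _ {C : Graph} {Z : Oracle} where

  infix 4 _⊢_⇓_
  _⊢_⇓_ : State → Cmd → State → Set
  σ ⊢ c ⇓ τ = Exec C Z c σ τ

  clear-exec : ∀ r σ → ∃[ τ ] σ ⊢ clear r ⇓ τ × τ r ≡ 0 × (∀ x → x ≢ r → τ x ≡ σ x)
  clear-exec r σ = go (σ r) σ refl
    where
    go : ∀ n σ → σ r ≡ n → ∃[ τ ] σ ⊢ clear r ⇓ τ × τ r ≡ 0 × (∀ x → x ≢ r → τ x ≡ σ x)
    go zero    σ eq = σ , done eq , eq , λ _ _ → refl
    go (suc n) σ eq =
      let τ , ex , τr , same = go n _ (trans (↦-same σ r _) (cong pred eq))
      in τ , again (cong positive eq) dec ex , τr , λ x x≢ → trans (same x x≢) (↦-other σ r _ x≢)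

  shift-exec : ∀ a b σ → b ≢ a →
    ∃[ τ ] σ ⊢ shift a b ⇓ τ × τ b ≡ σ a + σ b × (∀ x → x ≢ a → x ≢ b → τ x ≡ σ x)
  shift-exec a b σ b≢a = go (σ a) σ refl
    where
    go : ∀ n σ → σ a ≡ n →
      ∃[ τ ] σ ⊢ shift a b ⇓ τ × τ b ≡ n + σ b × (∀ x → x ≢ a → x ≢ b → τ x ≡ σ x)
    go zero    σ eq = σ , done eq , refl , λ _ _ _ → refl
    go (suc n) σ eq =
      let σ₁ = σ [ a ↦ pred (σ a) ]
          σ₂ = σ₁ [ b ↦ suc (σ₁ b) ]
          τ , ex , τb , same = go n σ₂ (trans (↦-other σ₁ b _ (≢-sym b≢a)) (trans (↦-same σ a _) (cong pred eq)))
      in τ , again (cong positive eq) (dec ⨾ inc) ex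
       , trans τb (trans (cong (n +_) (trans (↦-same σ₁ b _) (cong suc (↦-other σ a _ b≢a)))) (+-suc n _))
       , λ x x≢a x≢b → trans (same x x≢a x≢b) (trans (↦-other σ₁ b _ x≢b) (↦-other σ a _ x≢a))

  split-exec : ∀ a b c σ → b ≢ a → c ≢ a → c ≢ b →
    ∃[ τ ] σ ⊢ split a b c ⇓ τ × τ a ≡ 0 × τ b ≡ σ a + σ b × τ c ≡ σ a + σ c
           × (∀ x → x ≢ a → x ≢ b → x ≢ c → τ x ≡ σ x)
  split-exec a b c σ b≢a c≢a c≢b = go (σ a) σ refl
    where
    go : ∀ n σ → σ a ≡ n →
      ∃[ τ ] σ ⊢ split a b c ⇓ τ × τ a ≡ 0 × τ b ≡ n + σ b × τ c ≡ n + σ c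
             × (∀ x → x ≢ a → x ≢ b → x ≢ c → τ x ≡ σ x)
    go zero    σ eq = σ , done eq , eq , refl , refl , λ _ _ _ _ → refl
    go (suc n) σ eq =
      let σ₁ = σ [ a ↦ pred (σ a) ]
          σ₂ = σ₁ [ b ↦ suc (σ₁ b) ]
          σ₃ = σ₂ [ c ↦ suc (σ₂ c) ]
          τ , ex , τa , τb , τc , same = go n σ₃
            (trans (↦-other σ₂ c _ (≢-sym c≢a)) (trans (↦-other σ₁ b _ (≢-sym b≢a))
              (trans (↦-same σ a _) (cong pred eq))))
      in τ , again (cong positive eq) (dec ⨾ inc ⨾ inc) ex , τa
       , trans τb (trans (cong (n +_) (trans (↦-other σ₂ c _ (≢-sym c≢b)) (trans (↦-same σ₁ b _)
           (cong suc (↦-other σ a _ b≢a))))) (+-suc n _))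
       , trans τc (trans (cong (n +_) (trans (↦-same σ₂ c _) (cong suc (trans (↦-other σ₁ b _ c≢b)
           (↦-other σ a _ c≢a))))) (+-suc n _))
       , λ x x≢a x≢b x≢c → trans (same x x≢a x≢b x≢c) (trans (↦-other σ₂ c _ x≢c)
           (trans (↦-other σ₁ b _ x≢b) (↦-other σ a _ x≢a)))

  move-exec : ∀ a b σ → b ≢ a →
    ∃[ τ ] σ ⊢ move a b ⇓ τ × τ b ≡ σ a × (∀ x → x ≢ a → x ≢ b → τ x ≡ σ x)
  move-exec a b σ b≢a =
    let τ₁ , ex₁ , zero₁ , same₁ = clear-exec b σ
        τ₂ , ex₂ , sum₂  , same₂ = shift-exec a b τ₁ b≢a
    in τ₂ , ex₁ ⨾ ex₂
     , trans sum₂ (trans (cong₂ _+_ (same₁ a (≢-sym b≢a)) zero₁) (+-identityʳ _))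
     , λ x x≢a x≢b → trans (same₂ x x≢a x≢b) (same₁ x x≢b)

  copy-exec : ∀ a b c σ → b ≢ a → c ≢ a → c ≢ b →
    ∃[ τ ] σ ⊢ copy a b c ⇓ τ × τ b ≡ σ a × (∀ x → x ≢ b → x ≢ c → τ x ≡ σ x)
  copy-exec a b c σ b≢a c≢a c≢b =
    let τ₁ , ex₁ , zero₁ , same₁ = clear-exec b σ
        τ₂ , ex₂ , zero₂ , same₂ = clear-exec c τ₁
        τ₃ , ex₃ , zero₃ , b₃ , c₃ , same₃ = split-exec a b c τ₂ b≢a c≢a c≢b
        τ₄ , ex₄ , sum₄ , same₄ = shift-exec c a τ₃ (≢-sym c≢a)
        a₂ = trans (same₂ a (≢-sym c≢a)) (same₁ a (≢-sym b≢a))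
        a₄ = trans sum₄ (trans (cong₂ _+_ (trans c₃ (cong₂ _+_ a₂ zero₂)) zero₃)
               (trans (+-identityʳ _) (+-identityʳ _)))
        b₄ = trans (same₄ b (≢-sym c≢b) b≢a) (trans b₃ (trans
               (cong₂ _+_ a₂ (trans (same₂ b (≢-sym c≢b)) zero₁)) (+-identityʳ _)))
    in τ₄ , ex₁ ⨾ ex₂ ⨾ ex₃ ⨾ ex₄ , b₄ , λ x x≢b x≢c → rest τ₄ a₄ x x≢b x≢c λ x≢a →
         trans (same₄ x x≢c x≢a) (trans (same₃ x x≢a x≢b x≢c) (trans (same₂ x x≢c) (same₁ x x≢b)))
    where
    rest : ∀ τ → τ a ≡ σ a → ∀ x → x ≢ b → x ≢ c → (x ≢ a → τ x ≡ σ x) → τ x ≡ σ x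
    rest τ τa x _ _ other with x ≟ a
    ... | yes refl = τa
    ... | no x≢a   = other x≢a

  above : ∀ k {f} → f < suc k + f
  above k = s≤s (m≤n+m _ k)

  Below : ℕ → State → State → Set
  Below f σ τ = ∀ x → x < f → τ x ≡ σ x

  below-map : ∀ {n f σ τ} {vs : Vec ℕ n} → All (_< f) vs → Below f σ τ → Vec.map τ vs ≡ Vec.map σ vs
  below-map []         same = refl
  below-map (v< ∷ vs<) same = cong₂ _∷_ (same _ v<) (below-map vs< same)

  weaken : ∀ {n f} k {vs : Vec ℕ n} → All (_< f) vs → All (_< k + f) vs
  weaken k = All.map λ v< → <-≤-trans v< (m≤n+m _ k)

  from-< : ∀ k f → All (_< k + f) (from k f)
  from-< zero    f = []
  from-< (suc k) f = above k ∷ subst (λ m → All (_< m) (from k (suc f))) (+-suc k f) (from-< k (suc f))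

  mutual
    -- The arguments lie below `f`, and counters there end as they began, because `copy` restores
    -- the one that it empties. Hence subterms can be evaluated one after another on the same
    -- arguments.
    compile-exec : ∀ {n} (e : Fn n) {vs} f σ → All (_< f) vs →
      ∃[ τ ] σ ⊢ compile e vs f ⇓ τ × τ f ≡ ⟦ e ⟧ (Vec.map σ vs) × Below f σ τ
    compile-exec (var i) {vs} f σ vs< =
      let v< = lookup⁺ vs< i
          τ , ex , eq , same = copy-exec (lookup vs i) f (suc f) σ (>⇒≢ v<) (>⇒≢ (m≤n⇒m≤1+n v<)) 1+n≢n
      in τ , ex , trans eq (sym (lookup-map i σ vs)) , λ x x<f → same x (<⇒≢ x<f) (<⇒≢ (m≤n⇒m≤1+n x<f))
    compile-exec zer f σ vs< =
      let τ , ex , eq , same = clear-exec f σ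
      in τ , ex , eq , λ x x<f → same x (<⇒≢ x<f)
    compile-exec (sucF e) f σ vs< =
      let τ , ex , eq , same = compile-exec e f σ vs<
      in _ , ex ⨾ inc , trans (↦-same τ f _) (cong suc eq)
       , λ x x<f → trans (↦-other τ f _ (<⇒≢ x<f)) (same x x<f)
    compile-exec (preF e) f σ vs< =
      let τ , ex , eq , same = compile-exec e f σ vs<
      in _ , ex ⨾ dec , trans (↦-same τ f _) (cong pred eq)
       , λ x x<f → trans (↦-other τ f _ (<⇒≢ x<f)) (same x x<f)
    compile-exec (ifz c d e) {vs} f σ vs< =
      let τ , ex , eq , same = compile-exec c f σ vs< in branches τ ex eq same _ refl
      where
      branches : ∀ τ → σ ⊢ compile c vs f ⇓ τ → τ f ≡ ⟦ c ⟧ (Vec.map σ vs) → Below f σ τ →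
        ∀ v → v ≡ ⟦ c ⟧ (Vec.map σ vs) →
        ∃[ υ ] σ ⊢ compile (ifz c d e) vs f ⇓ υ
             × υ f ≡ ifZero (⟦ c ⟧ (Vec.map σ vs)) (⟦ d ⟧ (Vec.map σ vs)) (⟦ e ⟧ (Vec.map σ vs)) × Below f σ υ
      branches τ ex eq same zero v≡ rewrite sym v≡ =
        let υ , ex′ , eq′ , same′ = compile-exec d f τ vs<
        in υ , ex ⨾ test false (cong positive eq) ex′ , trans eq′ (cong ⟦ d ⟧ (below-map vs< same))
         , λ x x<f → trans (same′ x x<f) (same x x<f)
      branches τ ex eq same (suc v) v≡ rewrite sym v≡ =
        let υ , ex′ , eq′ , same′ = compile-exec e f τ vs<
        in υ , ex ⨾ test true (cong positive eq) ex′ , trans eq′ (cong ⟦ e ⟧ (below-map vs< same))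
         , λ x x<f → trans (same′ x x<f) (same x x<f)
    compile-exec (iter c d e f₁ f₂) {vs} f σ vs< =
      let τ₁ , ex₁ , eq₁ , same₁ = compile-exec d f σ vs<
          τ₂ , ex₂ , eq₂ , same₂ = compile-exec e (1 + f) τ₁ (weaken 1 vs<)
          τ₃ , ex₃ , eq₃ , same₃ = compile-exec c (2 + f) τ₂ (weaken 2 vs<)
          below₂ = λ x x<f → trans (same₂ x (m≤n⇒m≤1+n x<f)) (same₁ x x<f)
          below₃ = λ x x<f → trans (same₃ x (m≤n⇒m≤o+n 2 x<f)) (below₂ x x<f)
          τ , ex , eq , same = loop-exec f₁ f₂ f τ₃ vs< (⟦ c ⟧ (Vec.map σ vs))
                                 (trans eq₃ (cong ⟦ c ⟧ (below-map vs< below₂)))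
          first = trans (same₃ f (above 1)) (trans (same₂ f ≤-refl) eq₁)
          second = trans (same₃ (1 + f) ≤-refl) (trans eq₂ (cong ⟦ e ⟧ (below-map vs< same₁)))
      in τ , ex₁ ⨾ ex₂ ⨾ ex₃ ⨾ ex
       , trans eq (cong₂ (λ ρ ab → proj₁ (loop (λ (a , b) → ⟦ f₁ ⟧ (a ∷ b ∷ ρ) , ⟦ f₂ ⟧ (a ∷ b ∷ ρ)) (⟦ c ⟧ (Vec.map σ vs)) ab))
                         (below-map vs< below₃) (cong₂ _,_ first second))
       , λ x x<f → trans (same x x<f) (below₃ x x<f)
    compile-exec (call {k} g es) {vs} f σ vs< =
      let τ₁ , ex₁ , eq₁ , same₁ = compile*-exec es f σ vs<
          τ₂ , ex₂ , eq₂ , same₂ = compile-exec g (k + f) τ₁ (from-< k f)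
          τ₃ , ex₃ , eq₃ , same₃ = fetchResult-exec k f τ₂
      in τ₃ , ex₁ ⨾ ex₂ ⨾ ex₃ , trans eq₃ (trans eq₂ (cong ⟦ g ⟧ eq₁))
       , λ x x<f → trans (same₃ x x<f) (trans (same₂ x (m≤n⇒m≤o+n k x<f)) (same₁ x x<f))

    fetchResult-exec : ∀ k f σ → ∃[ τ ] σ ⊢ fetchResult k f ⇓ τ × τ f ≡ σ (k + f) × Below f σ τ
    fetchResult-exec zero    f σ = σ , skip , refl , λ _ _ → refl
    fetchResult-exec (suc k) f σ =
      let τ , ex , eq , same = move-exec (suc k + f) f σ (<⇒≢ (above k))
      in τ , ex , eq , λ x x<f → same x (<⇒≢ (m≤n⇒m≤o+n (suc k) x<f)) (<⇒≢ x<f)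

    compile*-exec : ∀ {n k} (es : Vec (Fn n) k) {vs} f σ → All (_< f) vs →
      ∃[ τ ] σ ⊢ compile* es vs f ⇓ τ × Vec.map τ (from k f) ≡ ⟦ es ⟧* (Vec.map σ vs) × Below f σ τ
    compile*-exec []       f σ vs< = σ , skip , refl , λ _ _ → refl
    compile*-exec (e ∷ es) f σ vs< =
      let τ₁ , ex₁ , eq₁ , same₁ = compile-exec e f σ vs<
          τ₂ , ex₂ , eq₂ , same₂ = compile*-exec es (suc f) τ₁ (weaken 1 vs<)
      in τ₂ , ex₁ ⨾ ex₂
       , cong₂ _∷_ (trans (same₂ f ≤-refl) eq₁) (trans eq₂ (cong ⟦ es ⟧* (below-map vs< same₁)))
       , λ x x<f → trans (same₂ x (m≤n⇒m≤1+n x<f)) (same₁ x x<f)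

    loop-exec : ∀ {n} (f₁ f₂ : Fn (2 + n)) {vs} f σ → All (_< f) vs → ∀ m → σ (2 + f) ≡ m →
      let ρ = Vec.map σ vs in
      ∃[ τ ] σ ⊢ while (2 + f) (iterBody f₁ f₂ vs f) ⇓ τ
           × τ f ≡ proj₁ (loop (λ (a , b) → ⟦ f₁ ⟧ (a ∷ b ∷ ρ) , ⟦ f₂ ⟧ (a ∷ b ∷ ρ)) m (σ f , σ (1 + f)))
           × Below f σ τ
    loop-exec f₁ f₂ f σ vs< zero    eq = σ , done eq , refl , λ _ _ → refl
    loop-exec f₁ f₂ {vs} f σ vs< (suc m) eq =
      let τ₀ = σ [ 2 + f ↦ pred (σ (2 + f)) ]
          ws< = above 2 ∷ above 1 ∷ weaken 3 vs<
          ws<′ = above 3 ∷ above 2 ∷ weaken 4 vs<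
          τ₁ , ex₁ , eq₁ , same₁ = compile-exec f₁ (3 + f) τ₀ ws<
          τ₂ , ex₂ , eq₂ , same₂ = compile-exec f₂ (4 + f) τ₁ ws<′
          τ₃ , ex₃ , eq₃ , same₃ = move-exec (3 + f) f τ₂ (<⇒≢ (above 2))
          τ₄ , ex₄ , eq₄ , same₄ = move-exec (4 + f) (1 + f) τ₃ (<⇒≢ (above 2))
          below₀ = λ x (x< : x < 2 + f) → ↦-other σ (2 + f) (pred (σ (2 + f))) (<⇒≢ x<)
          below₁ = λ x (x< : x < 2 + f) → trans (same₁ x (m≤n⇒m≤1+n x<)) (below₀ x x<)
          below₂ = λ x (x< : x < 2 + f) → trans (same₂ x (m≤n⇒m≤o+n 2 x<)) (below₁ x x<)
          below₄ = λ x (x< : x < f) → trans (same₄ x (<⇒≢ (m≤n⇒m≤o+n 4 x<)) (<⇒≢ (m≤n⇒m≤1+n x<)))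
            (trans (same₃ x (<⇒≢ (m≤n⇒m≤o+n 3 x<)) (<⇒≢ x<)) (below₂ x (m≤n⇒m≤o+n 2 x<)))
          args₀ = below-map (above 1 ∷ ≤-refl ∷ weaken 2 vs<) below₀
          args₁ = below-map (above 1 ∷ ≤-refl ∷ weaken 2 vs<) below₁
          count₄ = trans (same₄ (2 + f) (λ ()) (λ ())) (trans (same₃ (2 + f) (λ ()) (λ ()))
            (trans (same₂ (2 + f) (above 1)) (trans (same₁ (2 + f) ≤-refl)
              (trans (↦-same σ (2 + f) _) (cong pred eq)))))
          first = trans (same₄ f (λ ()) (λ ())) (trans eq₃ (trans (same₂ (3 + f) ≤-refl)
            (trans eq₁ (cong ⟦ f₁ ⟧ args₀))))
          second = trans eq₄ (trans (same₃ (4 + f) (λ ()) (λ ())) (trans eq₂ (cong ⟦ f₂ ⟧ args₁)))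
          τ , ex , eq′ , same = loop-exec f₁ f₂ f τ₄ vs< m count₄
      in τ , again (cong positive eq) (dec ⨾ ex₁ ⨾ ex₂ ⨾ ex₃ ⨾ ex₄) ex
       , trans eq′ (cong₂ (λ ρ ab → proj₁ (loop (λ (a , b) → ⟦ f₁ ⟧ (a ∷ b ∷ ρ) , ⟦ f₂ ⟧ (a ∷ b ∷ ρ)) m ab))
                          (below-map vs< below₄) (cong₂ _,_ first second))
       , λ x x<f → trans (same x x<f) (below₄ x x<f)

-- Sequences

loop-suc : ∀ {a} {A : Set a} (f : A → A) n x → loop f n (f x) ≡ f (loop f n x)
loop-suc f zero    x = refl
loop-suc f (suc n) x = loop-suc f n (f x)

-- Searches are run for more rounds than they need; once the state is stationary, the surplus rounds
-- are harmless.
loop-fix : ∀ {a} {A : Set a} (f : A → A) n {x} → f x ≡ x → loop f n x ≡ x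
loop-fix f zero    eq = refl
loop-fix f (suc n) eq = trans (cong (loop f n) eq) (loop-fix f n eq)

v₀ : ∀ {n} → Fn (1 + n)
v₀ = var zero
v₁ : ∀ {n} → Fn (2 + n)
v₁ = var (suc zero)

opaque
  addF : Fn 2
  addF = iter v₀ v₁ zer (sucF v₀) zer

  addF-eval : ∀ a b → ⟦ addF ⟧ (a ∷ b ∷ []) ≡ a + b
  addF-eval zero    b = refl
  addF-eval (suc a) b = trans (addF-eval a (suc b)) (+-suc a b)

  triangleF : Fn 1
  triangleF = iter v₀ zer zer (sucF (call addF (v₀ ∷ v₁ ∷ []))) (sucF v₁)

  triangleF-eval : ∀ n → ⟦ triangleF ⟧ (n ∷ []) ≡ triangle n
  triangleF-eval n = cong proj₁ (go n)
    where
    step : ℕ × ℕ → ℕ × ℕ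
    step (a , b) = suc (⟦ addF ⟧ (a ∷ b ∷ [])) , suc b
    go : ∀ n → loop step n (0 , 0) ≡ (triangle n , n)
    go zero    = refl
    go (suc n) rewrite loop-suc step n (0 , 0) | go n | addF-eval (triangle n) n = refl

  pairF : Fn 2
  pairF = call addF (call triangleF (addF ∷ []) ∷ v₁ ∷ [])

  pairF-eval : ∀ a b → ⟦ pairF ⟧ (a ∷ b ∷ []) ≡ pair a b
  pairF-eval a b
    rewrite addF-eval a b | triangleF-eval (a + b) = addF-eval _ b

  -- `unpair n` is the `n`-th iterate of `next-pair` at `(0 , 0)`. `sndF` runs the same iteration
  -- with the components exchanged, since the first one is returned.
  fstF : Fn 1
  fstF = iter v₀ zer zer (ifz v₀ (sucF v₁) (preF v₀)) (ifz v₀ zer (sucF v₁))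

  fstF-eval : ∀ n → ⟦ fstF ⟧ (n ∷ []) ≡ proj₁ (unpair n)
  fstF-eval n = cong proj₁ (go n)
    where
    step : ℕ × ℕ → ℕ × ℕ
    step (a , b) = ifZero a (suc b) (pred a) , ifZero a 0 (suc b)
    step≡next : ∀ x → step x ≡ next-pair x
    step≡next (zero  , b) = refl
    step≡next (suc a , b) = refl
    go : ∀ n → loop step n (0 , 0) ≡ unpair n
    go zero    = refl
    go (suc n) rewrite loop-suc step n (0 , 0) | go n = step≡next (unpair n)

  sndF : Fn 1
  sndF = iter v₀ zer zer (ifz v₁ zer (sucF v₀)) (ifz v₁ (sucF v₀) (preF v₁))

  sndF-eval : ∀ n → ⟦ sndF ⟧ (n ∷ []) ≡ proj₂ (unpair n)
  sndF-eval n = cong proj₁ (go n)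
    where
    step : ℕ × ℕ → ℕ × ℕ
    step (b , a) = ifZero a 0 (suc b) , ifZero a (suc b) (pred a)
    swap : ℕ × ℕ → ℕ × ℕ
    swap (a , b) = b , a
    step≡next : ∀ x → step (swap x) ≡ swap (next-pair x)
    step≡next (zero  , b) = refl
    step≡next (suc a , b) = refl
    go : ∀ n → loop step n (0 , 0) ≡ swap (unpair n)
    go zero    = refl
    go (suc n) rewrite loop-suc step n (0 , 0) | go n = step≡next (unpair n)

  -- The predecessor undoes the successor in `encode`. As `unpair 0` is `(0 , 0)`, head and tail of
  -- the empty list are 0, which agrees with reading squares outside a tape's lists as blank.
  hdF : Fn 1
  hdF = call fstF (preF v₀ ∷ [])

  tlF : Fn 1
  tlF = call sndF (preF v₀ ∷ [])

  consF : Fn 2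
  consF = sucF pairF

hd tl : ℕ → ℕ
hd n = ⟦ hdF ⟧ (n ∷ [])
tl n = ⟦ tlF ⟧ (n ∷ [])

cons : ℕ → ℕ → ℕ
cons a b = ⟦ consF ⟧ (a ∷ b ∷ [])

fst-pair : ∀ a b → ⟦ fstF ⟧ (pair a b ∷ []) ≡ a
fst-pair a b = trans (fstF-eval (pair a b)) (cong proj₁ (unpair-pair a b))

snd-pair : ∀ a b → ⟦ sndF ⟧ (pair a b ∷ []) ≡ b
snd-pair a b = trans (sndF-eval (pair a b)) (cong proj₂ (unpair-pair a b))

opaque
  unfolding hdF tlF consF

  hd-nil : hd 0 ≡ 0
  hd-nil = fstF-eval 0

  tl-nil : tl 0 ≡ 0
  tl-nil = sndF-eval 0

  hd-encode : ∀ x xs → hd (encode (x ∷ xs)) ≡ x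
  hd-encode x xs = fst-pair x (encode xs)

  tl-encode : ∀ x xs → tl (encode (x ∷ xs)) ≡ encode xs
  tl-encode x xs = snd-pair x (encode xs)

  cons-encode : ∀ x xs → cons x (encode xs) ≡ encode (x ∷ xs)
  cons-encode x xs = cong suc (pairF-eval x (encode xs))

nthF : ℕ → Fn 1
nthF zero    = hdF
nthF (suc k) = call (nthF k) (tlF ∷ [])

-- The default 0 codes the empty list, which `decodeInstr` reads as `halt`; so positions beyond the
-- end of a program behave as in `fetch`.
nth : List ℕ → ℕ → ℕ
nth []       _       = 0
nth (x ∷ xs) zero    = x
nth (x ∷ xs) (suc k) = nth xs k

nthF-encode : ∀ k xs → ⟦ nthF k ⟧ (encode xs ∷ []) ≡ nth xs k
nthF-encode zero    []       = hd-nil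
nthF-encode zero    (x ∷ xs) = hd-encode x xs
nthF-encode (suc k) []       = trans (cong (λ n → ⟦ nthF k ⟧ (n ∷ [])) tl-nil) (nthF-encode k [])
nthF-encode (suc k) (x ∷ xs) =
  trans (cong (λ n → ⟦ nthF k ⟧ (n ∷ [])) (tl-encode x xs)) (nthF-encode k xs)

listF : ∀ {n} → List (Fn n) → Fn n
listF []       = zer
listF (e ∷ es) = call consF (e ∷ listF es ∷ [])

listF-eval : ∀ {n} (es : List (Fn n)) ρ → ⟦ listF es ⟧ ρ ≡ encode (map (λ e → ⟦ e ⟧ ρ) es)
listF-eval []       ρ = refl
listF-eval (e ∷ es) ρ = trans (cong (cons (⟦ e ⟧ ρ)) (listF-eval es ρ)) (cons-encode _ _)

-- Machines that respond to their state by a primitive recursive function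

module _ {A : Set} (_⟶_ : A → A → Set) where

  Plus : A → A → Set
  Plus a b = ∃[ c ] a ⟶ c × Star _⟶_ c b

  Live : (A → Set) → A → Set
  Live Inv a = ∃[ b ] Star _⟶_ a b × Inv b

  -- At least one step is demanded, so that infinitely many finite pieces join to an infinite run.
  Progress : (A → Set) → Set
  Progress Inv = ∀ {a} → Inv a → ∃[ b ] Plus a b × Inv b

  live-step : ∀ {Inv} → Progress Inv → ∀ {a} → Live Inv a → ∃[ b ] a ⟶ b × Live Inv b
  live-step progress (b , ε , inv)           =
    let c , (d , a⟶d , d⟶*c) , inv′ = progress inv in d , a⟶d , c , d⟶*c , inv′
  live-step progress (b , a⟶c ◅ c⟶*b , inv) = _ , a⟶c , b , c⟶*b , inv

  forever : ∀ {Inv} → Progress Inv → ∀ {a} → Live Inv a → ∃[ f ] f 0 ≡ a × (∀ n → f n ⟶ f (suc n))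
  forever {Inv} progress {a} live =
    proj₁ ∘ run , refl , λ n → proj₁ (proj₂ (live-step progress (proj₂ (run n))))
    where
    run : ℕ → ∃ (Live Inv)
    run zero    = a , live
    run (suc n) = let b , _ , live′ = live-step progress (proj₂ (run n)) in b , live′

data Response : Set where
  finish : (output : ℕ) → Response
  goto   : (s : ℕ) → Response
  lookUp : (x s₁ s₀ : ℕ) → Response
  askFor : (e m s₁ s₀ : ℕ) → Response

-- Entry 0 is the kind, and it is 0 only for `finish`, which ends the main loop. The last entry is
-- at once the output, the next state and the state after a negative answer, so `become 4` serves
-- all three.
fields : Response → List ℕ
fields (finish k)         = 0 ∷ 0 ∷ 0 ∷ 0 ∷ k ∷ []
fields (goto s)           = 1 ∷ 0 ∷ 0 ∷ 0 ∷ s ∷ []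
fields (lookUp x s₁ s₀)   = 2 ∷ 0 ∷ x ∷ s₁ ∷ s₀ ∷ []
fields (askFor e m s₁ s₀) = 3 ∷ e ∷ m ∷ s₁ ∷ s₀ ∷ []

opaque
  code : Response → ℕ
  code ρ = encode (fields ρ)

  code-fields : ∀ ρ → code ρ ≡ encode (fields ρ)
  code-fields ρ = refl

module Machine (F : Fn 1) where

  fieldF : ℕ → Fn 1
  fieldF k = call (nthF k) (F ∷ [])

  opaque
    load : ℕ → ℕ → Cmd
    load k f = compile (fieldF k) (0 ∷ []) f

    load-exec : ∀ {C Z} k f σ → 0 < f →
      ∃[ τ ] Exec C Z (load k f) σ τ × τ f ≡ ⟦ fieldF k ⟧ (σ 0 ∷ []) × Below {C} {Z} f σ τ
    load-exec k f σ 0<f = compile-exec (fieldF k) f σ (0<f ∷ [])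

  become : ℕ → Cmd
  become k = load k 1 ⨾ move 1 0

  -- Counter 0 holds the state and counter 1 the kind, which is positive inside the loop. After one
  -- decrement 0 means `goto`, after a second one 0 means `lookUp` and otherwise `askFor`.
  transit : Cmd
  transit =
    dec 1 ⨾ test (nonzero 1)
      (dec 1 ⨾ test (nonzero 1)
        (load 1 1 ⨾ load 2 2 ⨾ test (converging 1 2) (become 3) (become 4))
        (load 2 1 ⨾ test (member 1) (become 3) (become 4)))
      (become 4)

  cycle : Cmd
  cycle = transit ⨾ load 0 1

  main : Cmd
  main = load 0 1 ⨾ while 1 cycle ⨾ become 4

  opaque
    machine : Program
    machine = assemble main 0 (halt ∷ [])

    loaded : Loaded machine 0 main × At machine (end main 0) (halt ∷ [])
    loaded = assemble-loaded main (halt ∷ []) (At-self machine)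

  module _ (C : Graph) (Z : Oracle) where

    data Next : Response → ℕ → Set where
      goto   : ∀ {s} → Next (goto s) s
      lookUp : ∀ {x s₁ s₀} → Next (lookUp x s₁ s₀) (if Z x then s₁ else s₀)
      askFor : ∀ {e m s₁ s₀} o → C (e , m , Z) o →
               Next (askFor e m s₁ s₀) (if isConvergent o then s₁ else s₀)

    _⟶_ : ℕ → ℕ → Set
    s ⟶ s′ = ∃[ ρ ] ⟦ F ⟧ (s ∷ []) ≡ code ρ × Next ρ s′

    private
      Steps : Config → Config → Set
      Steps = Star (Step C machine Z)

    Runs : Cmd → State → State → Set
    Runs = Exec C Z

    become-exec : ∀ k σ → ∃[ τ ] Runs (become k) σ τ × τ 0 ≡ ⟦ fieldF k ⟧ (σ 0 ∷ [])
    become-exec k σ =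
      let τ₁ , ex₁ , eq₁ , _ = load-exec k 1 σ (s≤s z≤n)
          τ₂ , ex₂ , eq₂ , _ = move-exec 1 0 τ₁ (λ ())
      in τ₂ , ex₁ ⨾ ex₂ , trans eq₂ eq₁

    module _ {s} {ρ} (F≡ : ⟦ F ⟧ (s ∷ []) ≡ code ρ) where

      fieldF-value : ∀ k → ⟦ fieldF k ⟧ (s ∷ []) ≡ nth (fields ρ) k
      fieldF-value k = trans (cong (λ n → ⟦ nthF k ⟧ (n ∷ [])) F≡) (trans (cong (λ n → ⟦ nthF k ⟧ (n ∷ [])) (code-fields ρ)) (nthF-encode k (fields ρ)))

      load-value : ∀ k f σ → 0 < f → σ 0 ≡ s →
        ∃[ τ ] Runs (load k f) σ τ × τ f ≡ nth (fields ρ) k × Below {C} {Z} f σ τ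
      load-value k f σ 0<f refl =
        let τ , ex , eq , same = load-exec k f σ 0<f
        in τ , ex , trans eq (fieldF-value k) , same

      become-value : ∀ k σ → σ 0 ≡ s → ∃[ τ ] Runs (become k) σ τ × τ 0 ≡ nth (fields ρ) k
      become-value k σ refl =
        let τ , ex , eq = become-exec k σ in τ , ex , trans eq (fieldF-value k)

      choose-exec : ∀ b σ → σ 0 ≡ s →
        ∃[ τ ] Runs (if b then become 3 else become 4) σ τ
             × τ 0 ≡ (if b then nth (fields ρ) 3 else nth (fields ρ) 4)
      choose-exec true  = become-value 3
      choose-exec false = become-value 4

    transit-exec : ∀ {s ρ s′} → ⟦ F ⟧ (s ∷ []) ≡ code ρ → Next ρ s′ →
      ∀ σ → σ 0 ≡ s → σ 1 ≡ nth (fields ρ) 0 → ∃[ τ ] Runs transit σ τ × τ 0 ≡ s′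
    transit-exec {ρ = goto _} F≡ goto σ σ0 σ1 =
      let τ , ex , eq = become-value {ρ = goto _} F≡ 4 (σ [ 1 ↦ pred (σ 1) ]) σ0
      in τ , dec ⨾ test false (cong (λ n → positive (pred n)) σ1) ex , eq
    transit-exec {ρ = lookUp x s₁ s₀} F≡ lookUp σ σ0 σ1 =
      let σ₁ = σ [ 1 ↦ pred (σ 1) ]
          σ₂ = σ₁ [ 1 ↦ pred (σ₁ 1) ]
          τ₁ , ex₁ , eq₁ , same₁ = load-value {ρ = lookUp x s₁ s₀} F≡ 2 1 σ₂ (s≤s z≤n) σ0
          τ₂ , ex₂ , eq₂ = choose-exec {ρ = lookUp x s₁ s₀} F≡ (Z x) τ₁ (trans (same₁ 0 (s≤s z≤n)) σ0)
      in τ₂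
       , dec ⨾ test true (cong (λ n → positive (pred n)) σ1)
           (dec ⨾ test false (cong (λ n → positive (pred (pred n))) σ1)
             (ex₁ ⨾ test (Z x) (cong Z eq₁) ex₂))
       , eq₂
    transit-exec {ρ = askFor e m s₁ s₀} F≡ (askFor o Co) σ σ0 σ1 =
      let σ₁ = σ [ 1 ↦ pred (σ 1) ]
          σ₂ = σ₁ [ 1 ↦ pred (σ₁ 1) ]
          τ₁ , ex₁ , eq₁ , same₁ = load-value {ρ = askFor e m s₁ s₀} F≡ 1 1 σ₂ (s≤s z≤n) σ0
          τ0 = trans (same₁ 0 (s≤s z≤n)) σ0
          τ₂ , ex₂ , eq₂ , same₂ = load-value {ρ = askFor e m s₁ s₀} F≡ 2 2 τ₁ (s≤s z≤n) τ0
          τ₃ , ex₃ , eq₃ = choose-exec {ρ = askFor e m s₁ s₀} F≡ (isConvergent o) τ₂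
                             (trans (same₂ 0 (s≤s z≤n)) τ0)
          Co′ = subst₂ (λ e m → C (e , m , Z) o) (sym (trans (same₂ 1 (s≤s (s≤s z≤n))) eq₁)) (sym eq₂) Co
      in τ₃
       , dec ⨾ test true (cong (λ n → positive (pred n)) σ1)
           (dec ⨾ test true (cong (λ n → positive (pred (pred n))) σ1)
             (ex₁ ⨾ ex₂ ⨾ test (isConvergent o) (o , Co′ , refl) ex₃))
       , eq₃

    -- The position is that of the test of the main loop, the one place where machine configurations
    -- are matched with abstract states.
    Head : ℕ → Config → Set
    Head s c = ∃[ T ] ∃[ σ ] c ≡ (end (load 0 1) 0 , T) × T ∼ σ × σ 0 ≡ s × σ 1 ≡ ⟦ fieldF 0 ⟧ (s ∷ [])

    Head-start : ∀ m → ∃[ c ] Steps (start m) c × Head m c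
    Head-start m =
      let τ , ex , eq , same = load-exec 0 1 ((λ _ → 0) [ 0 ↦ m ]) (s≤s z≤n)
          T , T∼τ , steps = Exec⇒Steps ex (proj₁ (proj₁ loaded)) (≔-∼ λ _ → [] , refl)
      in (_ , T) , steps , T , τ , refl , T∼τ , same 0 (s≤s z≤n) , eq

    Head-step : ∀ {s s′ c} → Head s c → s ⟶ s′ → ∃[ c′ ] Plus (Step C machine Z) c c′ × Head s′ c′
    Head-step {s} {s′} (T , σ , refl , T∼σ , σ0 , σ1) (ρ , F≡ , nx) =
      let kind = trans σ1 (fieldF-value {ρ = ρ} F≡ 0)
          τ₁ , ex₁ , eq₁ = transit-exec F≡ nx σ σ0 kind
          τ₂ , ex₂ , eq₂ , same₂ = load-exec 0 1 τ₁ (s≤s z≤n)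
          test₁ , ld , jump₁ = proj₁ (proj₂ (proj₁ loaded))
          T′ , T′∼τ , steps = Exec⇒Steps (ex₁ ⨾ ex₂) ld T∼σ
      in (_ , T′)
       , (_ , testStep (nonzero 1) true T∼σ test₁ (trans (cong positive kind) (running nx))
            , steps ◅◅ jump jump₁ ◅ ε)
       , T′ , τ₂ , refl , T′∼τ , trans (same₂ 0 (s≤s z≤n)) eq₁
       , trans eq₂ (cong (λ n → ⟦ fieldF 0 ⟧ (n ∷ [])) eq₁)
      where
      running : ∀ {ρ s′} → Next ρ s′ → positive (nth (fields ρ) 0) ≡ true
      running goto         = refl
      running lookUp       = refl
      running (askFor _ _) = refl

    Head-stop : ∀ {s c k} → Head s c → ⟦ F ⟧ (s ∷ []) ≡ code (finish k) →
      ∃[ c′ ] Steps c c′ × action machine Z c′ ≡ stop k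
    Head-stop {k = k} (T , σ , refl , T∼σ , σ0 , σ1) F≡ =
      let kind = trans σ1 (fieldF-value {ρ = finish k} F≡ 0)
          τ , ex , eq = become-value {ρ = finish k} F≡ 4 σ σ0
          test₁ , _ = proj₁ (proj₂ (proj₁ loaded))
          T′ , T′∼τ , steps = Exec⇒Steps ex (proj₂ (proj₂ (proj₁ loaded))) T∼σ
      in (_ , T′) , testStep (nonzero 1) false T∼σ test₁ (cong positive kind) ◅ steps
       , stops T′ τ T′∼τ eq
      where
      stops : ∀ T τ → T ∼ τ → τ 0 ≡ k → action machine Z (end main 0 , T) ≡ stop k
      stops T τ T∼τ eq rewrite proj₁ (proj₂ loaded) | proj₂ (T∼τ 0) | value-numeral (proj₁ (T∼τ 0)) (τ 0) =
        cong stop eq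

    Head-steps : ∀ {s s′ c} → Head s c → Star _⟶_ s s′ → ∃[ c′ ] Steps c c′ × Head s′ c′
    Head-steps head ε            = _ , ε , head
    Head-steps head (move ◅ moves) =
      let c₁ , (_ , step , steps) , head₁ = Head-step head move
          c₂ , steps₂ , head₂ = Head-steps head₁ moves
      in c₂ , step ◅ steps ◅◅ steps₂ , head₂

    -- Counter 0 starts with the input, so the input itself is the initial abstract state.
    convergent : ∀ {m s k} → Star _⟶_ m s → ⟦ F ⟧ (s ∷ []) ≡ code (finish k) →
      Γ C (index machine , m , Z) (↓ k)
    convergent {m} moves F≡ =
      let c₀ , steps₀ , head₀ = Head-start m
          c₁ , steps₁ , head₁ = Head-steps head₀ moves
          c₂ , steps₂ , stops = Head-stop head₁ F≡
      in halts (subst (λ P → Star (Step C P Z) (start m) c₂) P≡ (steps₀ ◅◅ steps₁ ◅◅ steps₂))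
               (subst (λ P → action P Z c₂ ≡ stop _) P≡ stops)
      where
      P≡ : machine ≡ program (index machine)
      P≡ = sym (program-index machine)

    divergent : ∀ {m Inv} → Progress _⟶_ Inv → Live _⟶_ Inv m → Γ C (index machine , m , Z) ↑
    divergent {m} {Inv} progress (s , moves , inv) =
      let c₀ , steps₀ , head₀ = Head-start m
          c₁ , steps₁ , head₁ = Head-steps head₀ moves
          f , f0 , f-steps = forever (Step C machine Z) head-progress (c₁ , steps₀ ◅◅ steps₁ , s , head₁ , inv)
      in runs-forever f f0
           (subst (λ P → ∀ n → Step C P Z (f n) (f (suc n))) (sym (program-index machine)) f-steps)
      where
      head-progress : Progress (Step C machine Z) (λ c → ∃[ s ] Head s c × Inv s)
      head-progress (s , head , inv) =
        let s₂ , (s₁ , move , moves) , inv₂ = progress inv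
            c₁ , (_ , step , steps₁) , head₁ = Head-step head move
            c₂ , steps₂ , head₂ = Head-steps head₁ moves
        in c₂ , (_ , step , steps₁ ◅◅ steps₂) , s₂ , head₂ , inv₂

-- Coded programs and tapes

pair-next : ∀ a b → let c , d = next-pair (a , b) in pair c d ≡ suc (pair a b)
pair-next zero    b rewrite +-identityʳ b | +-identityʳ (triangle b + b) = refl
pair-next (suc a) b rewrite +-suc a b = +-suc _ b

pair-unpair : ∀ n → pair (proj₁ (unpair n)) (proj₂ (unpair n)) ≡ n
pair-unpair zero    = refl
pair-unpair (suc n) = trans (pair-next (proj₁ (unpair n)) _) (cong suc (pair-unpair n))

encode-decode-fuel : ∀ f n → n ≤ f → encode (decode-fuel f n) ≡ n
encode-decode-fuel f       zero    _       = refl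
encode-decode-fuel (suc f) (suc n) (s≤s n≤f) with unpair n | pair-unpair n
... | x , rest | refl =
  cong (λ m → suc (pair x m)) (encode-decode-fuel f rest (≤-trans (m≤n+m rest (triangle (x + rest))) n≤f))

-- An arbitrary index need not be of the form `index P`. Surjectivity of the coding lets the
-- interpreter treat every number as the code of a list.
encode-decode : ∀ n → encode (decode n) ≡ n
encode-decode n = encode-decode-fuel n n ≤-refl

-- Traversals of a list can therefore take its code as the number of rounds.
length≤encode : ∀ xs → length xs ≤ encode xs
length≤encode []       = z≤n
length≤encode (x ∷ xs) = s≤s (≤-trans (length≤encode xs) (m≤n+m _ (triangle (x + encode xs))))

opaque
  -- 0 when the arguments are equal, 1 otherwise
  neqF : Fn 2
  neqF = call (ifz v₀ (sucF zer) (ifz (preF v₀) zer (sucF zer)))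
              (iter v₀ (sucF v₁) zer (preF v₀) zer ∷ [])

  -- Decrementing `suc n` for `m` rounds leaves 1 exactly if `m` equals `n`. The consumer `f` stands
  -- for the context in which the test occurs, so only its values at 0 and 1 matter.
  neqF-eval : ∀ {a} {A : Set a} m n (f : ℕ → A) {x y} → f 0 ≡ x → f 1 ≡ y →
    f (⟦ neqF ⟧ (m ∷ n ∷ [])) ≡ (if m ≡ᵇ n then x else y)
  neqF-eval zero    zero    f eq₀ eq₁ = eq₀
  neqF-eval zero    (suc n) f eq₀ eq₁ = eq₁
  neqF-eval (suc m) zero    f eq₀ eq₁ =
    trans (cong (λ d → f (ifZero d 1 (ifZero (pred d) 0 1)))
                (cong proj₁ (loop-fix (λ (a , b) → pred a , 0) m {0 , 0} refl))) eq₁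
  neqF-eval (suc m) (suc n) f eq₀ eq₁ = neqF-eval m n f eq₀ eq₁

  fetchF : Fn 2
  fetchF = call hdF (iter v₁ v₀ zer (call tlF (v₀ ∷ [])) zer ∷ [])

  fetchF-eval : ∀ p xs → ⟦ fetchF ⟧ (encode xs ∷ p ∷ []) ≡ nth xs p
  fetchF-eval p xs = go p xs 0
    where
    go : ∀ p xs b → hd (proj₁ (loop (λ (a , b) → tl a , 0) p (encode xs , b))) ≡ nth xs p
    go zero    []       b = hd-nil
    go zero    (x ∷ xs) b = hd-encode x xs
    go (suc p) []       b rewrite tl-nil = go p [] 0
    go (suc p) (x ∷ xs) b rewrite tl-encode x xs = go p xs 0

fetch-decode : ∀ xs p → fetch (map (λ n → decodeInstr (decode n)) xs) p ≡ decodeInstr (decode (nth xs p))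
fetch-decode []       p       = refl
fetch-decode (x ∷ xs) zero    = refl
fetch-decode (x ∷ xs) (suc p) = fetch-decode xs p

instruction : ℕ → ℕ → List ℕ
instruction e p = decode (nth (decode e) p)

fetchF-instruction : ∀ e p → ⟦ fetchF ⟧ (e ∷ p ∷ []) ≡ encode (instruction e p)
fetchF-instruction e p =
  trans (cong (λ n → ⟦ fetchF ⟧ (n ∷ p ∷ [])) (sym (encode-decode e)))
    (trans (fetchF-eval p (decode e)) (sym (encode-decode _)))

bit : Bool → ℕ
bit true  = 1
bit false = 0

⌜_⌝ᵇ : List Bool → ℕ
⌜ bs ⌝ᵇ = encode (map bit bs)

⌜_⌝ : Tape → ℕ
⌜ l , r ⌝ = pair ⌜ l ⌝ᵇ ⌜ r ⌝ᵇ

numF : ∀ {n} → ℕ → Fn n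
numF zero    = zer
numF (suc k) = sucF (numF k)

numF-eval : ∀ {n} k (ρ : Vec ℕ n) → ⟦ numF k ⟧ ρ ≡ k
numF-eval zero    ρ = refl
numF-eval (suc k) ρ = cong suc (numF-eval k ρ)

opaque
  scanF leftF rightF valueF numeralF : Fn 1
  scanF    = call hdF (sndF ∷ [])
  leftF    = call pairF (call tlF (fstF ∷ []) ∷ call consF (call hdF (fstF ∷ []) ∷ sndF ∷ []) ∷ [])
  rightF   = call pairF (call consF (call hdF (sndF ∷ []) ∷ fstF ∷ []) ∷ call tlF (sndF ∷ []) ∷ [])
  valueF   = call (iter v₀ zer v₀ (ifz (call hdF (v₁ ∷ [])) v₀ (sucF v₀))
                                  (ifz (call hdF (v₁ ∷ [])) v₁ (call tlF (v₁ ∷ []))))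
                  (sndF ∷ [])
  numeralF = call pairF (zer ∷ iter v₀ zer zer (call consF (sucF zer ∷ v₀ ∷ [])) zer ∷ [])

  writeF : Bool → Fn 1
  writeF b = call pairF (fstF ∷ call consF (numF (bit b) ∷ call tlF (sndF ∷ []) ∷ []) ∷ [])

  scanF-eval : ∀ T → ⟦ scanF ⟧ (⌜ T ⌝ ∷ []) ≡ bit (scan T)
  scanF-eval (l , r) rewrite snd-pair ⌜ l ⌝ᵇ ⌜ r ⌝ᵇ with r
  ... | []    = hd-nil
  ... | b ∷ r = hd-encode (bit b) (map bit r)

  leftF-eval : ∀ T → ⟦ leftF ⟧ (⌜ T ⌝ ∷ []) ≡ ⌜ moveLeft T ⌝
  leftF-eval (l , r) rewrite fst-pair ⌜ l ⌝ᵇ ⌜ r ⌝ᵇ | snd-pair ⌜ l ⌝ᵇ ⌜ r ⌝ᵇ with l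
  ... | []    rewrite tl-nil | hd-nil | cons-encode 0 (map bit r) = pairF-eval _ _
  ... | b ∷ l rewrite tl-encode (bit b) (map bit l) | hd-encode (bit b) (map bit l)
                    | cons-encode (bit b) (map bit r) = pairF-eval _ _

  rightF-eval : ∀ T → ⟦ rightF ⟧ (⌜ T ⌝ ∷ []) ≡ ⌜ moveRight T ⌝
  rightF-eval (l , r) rewrite fst-pair ⌜ l ⌝ᵇ ⌜ r ⌝ᵇ | snd-pair ⌜ l ⌝ᵇ ⌜ r ⌝ᵇ with r
  ... | []    rewrite tl-nil | hd-nil | cons-encode 0 (map bit l) = pairF-eval _ _
  ... | b ∷ r rewrite tl-encode (bit b) (map bit r) | hd-encode (bit b) (map bit r)
                    | cons-encode (bit b) (map bit l) = pairF-eval _ _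

  writeF-eval : ∀ b T → ⟦ writeF b ⟧ (⌜ T ⌝ ∷ []) ≡ ⌜ write b T ⌝
  writeF-eval b (l , r)
    rewrite fst-pair ⌜ l ⌝ᵇ ⌜ r ⌝ᵇ | snd-pair ⌜ l ⌝ᵇ ⌜ r ⌝ᵇ | numF-eval (bit b) (⌜ l , r ⌝ ∷ []) = go r
    where
    go : ∀ r → ⟦ pairF ⟧ (⌜ l ⌝ᵇ ∷ cons (bit b) (tl ⌜ r ⌝ᵇ) ∷ []) ≡ ⌜ write b (l , r) ⌝
    go []      rewrite tl-nil | cons-encode (bit b) [] = pairF-eval _ _
    go (x ∷ r) rewrite tl-encode (bit x) (map bit r) | cons-encode (bit b) (map bit r) = pairF-eval _ _

  valueF-eval : ∀ T → ⟦ valueF ⟧ (⌜ T ⌝ ∷ []) ≡ value T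
  valueF-eval (l , r) rewrite snd-pair ⌜ l ⌝ᵇ ⌜ r ⌝ᵇ =
    go ⌜ r ⌝ᵇ r 0 (subst (_≤ ⌜ r ⌝ᵇ) (length-bits r) (length≤encode (map bit r)))
    where
    length-bits : ∀ r → length (map bit r) ≡ length r
    length-bits []      = refl
    length-bits (b ∷ r) = cong suc (length-bits r)
    step : ℕ × ℕ → ℕ × ℕ
    step (n , c) = ifZero (hd c) n (suc n) , ifZero (hd c) c (tl c)
    stay : ∀ n c → hd c ≡ 0 → step (n , c) ≡ (n , c)
    stay n c eq rewrite eq = refl
    go : ∀ k r n → length r ≤ k → proj₁ (loop step k (n , ⌜ r ⌝ᵇ)) ≡ n + length (takeWhileᵇ id r)
    go k       []          n _ = trans (cong proj₁ (loop-fix step k (stay n 0 hd-nil))) (sym (+-identityʳ n))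
    go k       (false ∷ r) n _ =
      trans (cong proj₁ (loop-fix step k (stay n _ (hd-encode 0 (map bit r))))) (sym (+-identityʳ n))
    go (suc k) (true ∷ r)  n (s≤s len) rewrite hd-encode 1 (map bit r) | tl-encode 1 (map bit r) =
      trans (go k r (suc n) len) (sym (+-suc n _))

  numeralF-eval : ∀ n → ⟦ numeralF ⟧ (n ∷ []) ≡ ⌜ numeral n ⌝
  numeralF-eval n = trans (pairF-eval _ _)
    (cong (pair 0) (trans (go n 0) (cong (λ m → ⌜ replicate m true ⌝ᵇ) (+-identityʳ n))))
    where
    go : ∀ n m → proj₁ (loop (λ (a , b) → cons 1 a , 0) n (⌜ replicate m true ⌝ᵇ , 0))
         ≡ ⌜ replicate (n + m) true ⌝ᵇ
    go zero    m = refl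
    go (suc n) m rewrite cons-encode 1 (map bit (replicate m true)) =
      trans (go n (suc m)) (cong (λ m → ⌜ replicate m true ⌝ᵇ) (+-suc n m))

-- The simulated tapes are kept as the list of all assignments made so far,
-- the latest first.
Log : Set
Log = List (ℕ × Tape)

tapes : Log → Tapes
tapes []              = λ _ → [] , []
tapes ((t , x) ∷ log) = tapes log [ t ≔ x ]

entry : ℕ × Tape → ℕ
entry (t , x) = pair t ⌜ x ⌝

⌜_⌝ˡ : Log → ℕ
⌜ log ⌝ˡ = encode (map entry log)

opaque
  lookF : Fn 2
  lookF = call sndF (call hdF (iter v₀ v₀ zer
    (ifz (call neqF (call fstF (call hdF (v₀ ∷ []) ∷ []) ∷ var (# 3) ∷ [])) v₀ (call tlF (v₀ ∷ []))) zer ∷ []) ∷ [])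

  lookF-eval : ∀ log t → ⟦ lookF ⟧ (⌜ log ⌝ˡ ∷ t ∷ []) ≡ ⌜ tapes log t ⌝
  lookF-eval log t =
    go ⌜ log ⌝ˡ log (subst (_≤ ⌜ log ⌝ˡ) (length-entries log) (length≤encode (map entry log)))
    where
    length-entries : ∀ log → length (map entry log) ≡ length log
    length-entries []        = refl
    length-entries (_ ∷ log) = cong suc (length-entries log)
    advance : ℕ → ℕ
    advance c = ifZero (⟦ neqF ⟧ (⟦ fstF ⟧ (hd c ∷ []) ∷ t ∷ [])) c (tl c)
    step : ℕ × ℕ → ℕ × ℕ
    step (c , _) = advance c , 0
    advance-cons : ∀ s x log → advance ⌜ (s , x) ∷ log ⌝ˡ ≡ (if s ≡ᵇ t then ⌜ (s , x) ∷ log ⌝ˡ else ⌜ log ⌝ˡ)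
    advance-cons s x log
      rewrite hd-encode (entry (s , x)) (map entry log) | fst-pair s ⌜ x ⌝ =
      neqF-eval s t (λ d → ifZero d ⌜ (s , x) ∷ log ⌝ˡ (tl ⌜ (s , x) ∷ log ⌝ˡ)) refl
        (tl-encode (entry (s , x)) (map entry log))
    advance-nil : advance 0 ≡ 0
    advance-nil rewrite tl-nil = const (⟦ neqF ⟧ (⟦ fstF ⟧ (hd 0 ∷ []) ∷ t ∷ []))
      where
      const : ∀ n → ifZero n 0 0 ≡ 0
      const zero    = refl
      const (suc n) = refl
    ≡ᵇ-sym : ∀ m n → (m ≡ᵇ n) ≡ (n ≡ᵇ m)
    ≡ᵇ-sym zero    zero    = refl
    ≡ᵇ-sym zero    (suc n) = refl
    ≡ᵇ-sym (suc m) zero    = refl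
    ≡ᵇ-sym (suc m) (suc n) = ≡ᵇ-sym m n
    found : ℕ → ℕ
    found c = ⟦ sndF ⟧ (hd c ∷ [])
    go : ∀ k log → length log ≤ k → found (proj₁ (loop step k (⌜ log ⌝ˡ , 0))) ≡ ⌜ tapes log t ⌝
    -- The default 0 of an exhausted log is also the code of the blank tape.
    go k []                    _ =
      trans (cong (found ∘ proj₁) (loop-fix step k (cong (_, 0) advance-nil)))
        (trans (cong (λ n → ⟦ sndF ⟧ (n ∷ [])) hd-nil) (sndF-eval 0))
    go (suc k) ((s , x) ∷ log) (s≤s len) rewrite advance-cons s x log | ≡ᵇ-sym t s with s ≡ᵇ t in eq
    ... | false = go k log len
    ... | true  =
      trans (cong (found ∘ proj₁) (loop-fix step k
              (cong (_, 0) (trans (advance-cons s x log) (cong (λ b → if b then ⌜ (s , x) ∷ log ⌝ˡ else ⌜ log ⌝ˡ) eq)))))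
        (trans (cong (λ n → ⟦ sndF ⟧ (n ∷ [])) (hd-encode (entry (s , x)) (map entry log))) (snd-pair s ⌜ x ⌝))

-- The interpreter

-- simulate runs a computation.  compare pits it against a rival: before a query
-- of the computation is answered, the rival is compared with the queried
-- computation.  resume is compare once that comparison has converged.
data Mode : Set where
  simulate compare resume : Mode

⌜_⌝ᵐ : Mode → ℕ
⌜ simulate ⌝ᵐ = 0
⌜ compare  ⌝ᵐ = 1
⌜ resume   ⌝ᵐ = 2

-- The interpreter has no access to its own index, which is therefore passed
-- on as self.  Side false computes with X and side true with Y.
record Task : Set where
  constructor task
  field
    side      : Bool
    self e    : ℕ
    rival     : ℕ × ℕ

stateFields : Mode → Task → ℕ → Log → List ℕ
stateFields k (task b r e (ηe , ηm)) p log = ⌜ k ⌝ᵐ ∷ bit b ∷ r ∷ e ∷ p ∷ ⌜ log ⌝ˡ ∷ ηe ∷ ηm ∷ []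

opaque
  state : Mode → Task → ℕ → Log → ℕ
  state k τ p log = encode (stateFields k τ p log)

  state-fields : ∀ k τ p log → state k τ p log ≡ encode (stateFields k τ p log)
  state-fields k τ p log = refl

launch : Mode → Task → ℕ → ℕ
launch k τ m = state k τ 0 ((0 , numeral m) ∷ [])

afterAnswer : Mode → Mode
afterAnswer simulate = simulate
afterAnswer _        = compare

respond : Mode → Task → ℕ → Log → Instr → Response
respond k τ p log (left t)       = goto (state k τ (suc p) ((t , moveLeft (tapes log t)) ∷ log))
respond k τ p log (right t)      = goto (state k τ (suc p) ((t , moveRight (tapes log t)) ∷ log))
respond k τ p log (mark t)       = goto (state k τ (suc p) ((t , write true (tapes log t)) ∷ log))
respond k τ p log (erase t)      = goto (state k τ (suc p) ((t , write false (tapes log t)) ∷ log))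
respond k τ p log (branch t x y) = goto (state k τ (if scan (tapes log t) then x else y) log)
respond k τ p log (oracle t x y) =
  let v = value (tapes log t) in
  lookUp (bit (Task.side τ) + (v + v)) (state k τ x log) (state k τ y log)
-- The rival becomes the computation and the queried computation its rival; the side flips because
-- opponents use different oracles.
respond compare τ@(task b r e (ηe , ηm)) p log (query t u x y) =
  askFor r (launch compare (task (not b) r ηe (value (tapes log t) , value (tapes log u))) ηm)
    -- Index 0 is the empty program, so the second state finishes at once: this is how a diverging
    -- comparison makes the machine halt.
    (state resume τ p log) (state simulate (task b r 0 (ηe , ηm)) p log)
respond k τ@(task b r e η) p log (query t u x y) =
  askFor r (launch simulate (task b r (value (tapes log t)) (0 , 0)) (value (tapes log u)))
    (state (afterAnswer k) τ x log) (state (afterAnswer k) τ y log)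
-- Only convergence of a simulation is ever used, so its output may be constant.
respond simulate τ p log halt = finish 0
respond k        τ p log halt = goto (state k τ p log)

-- The interpreter's response as a primitive recursive function

stateF : ∀ {n} (k b r e p log ηe ηm : Fn n) → Fn n
stateF k b r e p log ηe ηm = listF (k ∷ b ∷ r ∷ e ∷ p ∷ log ∷ ηe ∷ ηm ∷ [])

launchF : ∀ {n} (k b r e m ηe ηm : Fn n) → Fn n
launchF k b r e m ηe ηm =
  stateF k b r e zer (listF (call pairF (zer ∷ call numeralF (m ∷ []) ∷ []) ∷ [])) ηe ηm

finishF gotoF : ∀ {n} → Fn n → Fn n
finishF k = listF (zer ∷ zer ∷ zer ∷ zer ∷ k ∷ [])
gotoF s   = listF (sucF zer ∷ zer ∷ zer ∷ zer ∷ s ∷ [])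

lookUpF : ∀ {n} (x s₁ s₀ : Fn n) → Fn n
lookUpF x s₁ s₀ = listF (numF 2 ∷ zer ∷ x ∷ s₁ ∷ s₀ ∷ [])

askForF : ∀ {n} (e m s₁ s₀ : Fn n) → Fn n
askForF e m s₁ s₀ = listF (numF 3 ∷ e ∷ m ∷ s₁ ∷ s₀ ∷ [])

module _ {n} (ρ : Vec ℕ n) where

  finishF-eval : ∀ k {x} → ⟦ k ⟧ ρ ≡ x → ⟦ finishF k ⟧ ρ ≡ code (finish x)
  finishF-eval k refl = trans (listF-eval (zer ∷ zer ∷ zer ∷ zer ∷ k ∷ []) ρ) (sym (code-fields _))

  gotoF-eval : ∀ s {x} → ⟦ s ⟧ ρ ≡ x → ⟦ gotoF s ⟧ ρ ≡ code (goto x)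
  gotoF-eval s refl = trans (listF-eval (sucF zer ∷ zer ∷ zer ∷ zer ∷ s ∷ []) ρ) (sym (code-fields (goto _)))

  lookUpF-eval : ∀ a s₁ s₀ {x y z} → ⟦ a ⟧ ρ ≡ x → ⟦ s₁ ⟧ ρ ≡ y → ⟦ s₀ ⟧ ρ ≡ z →
    ⟦ lookUpF a s₁ s₀ ⟧ ρ ≡ code (lookUp x y z)
  lookUpF-eval a s₁ s₀ refl refl refl = trans (listF-eval (numF 2 ∷ zer ∷ a ∷ s₁ ∷ s₀ ∷ []) ρ) (sym (code-fields _))

  askForF-eval : ∀ e m s₁ s₀ {w x y z} → ⟦ e ⟧ ρ ≡ w → ⟦ m ⟧ ρ ≡ x → ⟦ s₁ ⟧ ρ ≡ y → ⟦ s₀ ⟧ ρ ≡ z →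
    ⟦ askForF e m s₁ s₀ ⟧ ρ ≡ code (askFor w x y z)
  askForF-eval e m s₁ s₀ refl refl refl refl = trans (listF-eval (numF 3 ∷ e ∷ m ∷ s₁ ∷ s₀ ∷ []) ρ) (sym (code-fields _))

  stateF-eval : ∀ k b r e p log ηe ηm {k′ b′ r′ e′ p′ log′ ηe′ ηm′} →
    ⟦ k ⟧ ρ ≡ ⌜ k′ ⌝ᵐ → ⟦ b ⟧ ρ ≡ bit b′ → ⟦ r ⟧ ρ ≡ r′ → ⟦ e ⟧ ρ ≡ e′ → ⟦ p ⟧ ρ ≡ p′ →
    ⟦ log ⟧ ρ ≡ ⌜ log′ ⌝ˡ → ⟦ ηe ⟧ ρ ≡ ηe′ → ⟦ ηm ⟧ ρ ≡ ηm′ →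
    ⟦ stateF k b r e p log ηe ηm ⟧ ρ ≡ state k′ (task b′ r′ e′ (ηe′ , ηm′)) p′ log′
  stateF-eval k b r e p log ηe ηm k≡ b≡ refl refl refl log≡ refl refl =
    trans (listF-eval (k ∷ b ∷ r ∷ e ∷ p ∷ log ∷ ηe ∷ ηm ∷ []) ρ) (trans (lemma k≡ b≡ log≡) (sym (state-fields _ _ _ _)))
    where
    lemma : ∀ {k k′ b b′ l l′ e p r x y} → k ≡ k′ → b ≡ b′ → l ≡ l′ →
            encode (k ∷ b ∷ r ∷ e ∷ p ∷ l ∷ x ∷ y ∷ []) ≡ encode (k′ ∷ b′ ∷ r ∷ e ∷ p ∷ l′ ∷ x ∷ y ∷ [])
    lemma refl refl refl = refl

  launchF-eval : ∀ k b r e m ηe ηm {k′ b′ r′ e′ m′ ηe′ ηm′} →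
    ⟦ k ⟧ ρ ≡ ⌜ k′ ⌝ᵐ → ⟦ b ⟧ ρ ≡ bit b′ → ⟦ r ⟧ ρ ≡ r′ → ⟦ e ⟧ ρ ≡ e′ → ⟦ m ⟧ ρ ≡ m′ →
    ⟦ ηe ⟧ ρ ≡ ηe′ → ⟦ ηm ⟧ ρ ≡ ηm′ →
    ⟦ launchF k b r e m ηe ηm ⟧ ρ ≡ launch k′ (task b′ r′ e′ (ηe′ , ηm′)) m′
  launchF-eval k b r e m ηe ηm k≡ b≡ r≡ e≡ refl ηe≡ ηm≡ =
    stateF-eval k b r e zer (listF (single ∷ [])) ηe ηm k≡ b≡ r≡ e≡ refl
      (trans (listF-eval (single ∷ []) ρ) (cong (λ x → encode (x ∷ []))
        (trans (pairF-eval 0 _) (cong (pair 0) (numeralF-eval (⟦ m ⟧ ρ))))))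
      ηe≡ ηm≡
    where
    single : Fn n
    single = call pairF (zer ∷ call numeralF (m ∷ []) ∷ [])

-- Variables of the functions below: the fields of a state, the state itself,
-- the proper tails of the current instruction, and its entries.
private
  kᵛ bᵛ rᵛ eᵛ pᵛ lᵛ ηeᵛ ηmᵛ sᵛ t₁ t₂ t₃ t₄ t₅ opᵛ x₁ x₂ x₃ x₄ : Fn 19
  kᵛ  = var (# 0)
  bᵛ  = var (# 1)
  rᵛ  = var (# 2)
  eᵛ  = var (# 3)
  pᵛ  = var (# 4)
  lᵛ  = var (# 5)
  ηeᵛ = var (# 6)
  ηmᵛ = var (# 7)
  sᵛ  = var (# 8)
  t₁  = var (# 9)
  t₂  = var (# 10)
  t₃  = var (# 11)
  t₄  = var (# 12)
  t₅  = var (# 13)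
  opᵛ = var (# 14)
  x₁  = var (# 15)
  x₂  = var (# 16)
  x₃  = var (# 17)
  x₄  = var (# 18)

  env : Mode → Task → ℕ → Log → List ℕ → Vec ℕ 19
  env k τ@(task b r e (ηe , ηm)) p log is =
    ⌜ k ⌝ᵐ ∷ bit b ∷ r ∷ e ∷ p ∷ ⌜ log ⌝ˡ ∷ ηe ∷ ηm ∷ state k τ p log
    ∷ encode (drop 1 is) ∷ encode (drop 2 is) ∷ encode (drop 3 is) ∷ encode (drop 4 is) ∷ encode (drop 5 is)
    ∷ nth is 0 ∷ nth is 1 ∷ nth is 2 ∷ nth is 3 ∷ nth is 4 ∷ []

tapeF : Fn 19 → Fn 19
tapeF t = call lookF (lᵛ ∷ t ∷ [])

jumpF : (k p : Fn 19) → Fn 19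
jumpF k p = stateF k bᵛ rᵛ eᵛ p lᵛ ηeᵛ ηmᵛ

assignF : Fn 1 → Fn 19
assignF f = gotoF (stateF kᵛ bᵛ rᵛ eᵛ (sucF pᵛ)
  (call consF (call pairF (x₁ ∷ call f (tapeF x₁ ∷ []) ∷ []) ∷ lᵛ ∷ [])) ηeᵛ ηmᵛ)

branchF oracleF resumeF queryF haltF : Fn 19
branchF = gotoF (jumpF kᵛ (ifz (call scanF (tapeF x₁ ∷ [])) x₃ x₂))
oracleF = lookUpF (call addF (bᵛ ∷ call addF (v ∷ v ∷ []) ∷ [])) (jumpF kᵛ x₂) (jumpF kᵛ x₃)
  where
  v : Fn 19
  v = call valueF (tapeF x₁ ∷ [])
resumeF =
  askForF rᵛ (launchF zer bᵛ rᵛ (call valueF (tapeF x₁ ∷ [])) (call valueF (tapeF x₂ ∷ [])) zer zer)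
    (jumpF k x₃) (jumpF k x₄)
  where
  k : Fn 19
  k = ifz kᵛ zer (sucF zer)
queryF = ifz kᵛ resumeF (ifz (preF kᵛ)
  (askForF rᵛ (launchF (sucF zer) (ifz bᵛ (sucF zer) zer) rᵛ ηeᵛ ηmᵛ
                 (call valueF (tapeF x₁ ∷ [])) (call valueF (tapeF x₂ ∷ [])))
    (jumpF (numF 2) pᵛ) (stateF zer bᵛ rᵛ zer pᵛ lᵛ ηeᵛ ηmᵛ))
  resumeF)
haltF = ifz kᵛ (finishF zer) (gotoF sᵛ)

-- `decodeInstr` accepts an opcode only in a list of the right length. A tail is nonempty exactly if
-- its code is nonzero, so testing two successive tails fixes the length at two or four. The empty
-- list shows opcode 0 but fails the length test, and so becomes `halt`.
twoF fourF : Fn 19 → Fn 19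
twoF f  = ifz t₁ haltF (ifz t₂ f haltF)
fourF f = ifz t₃ haltF (ifz t₄ f haltF)

respondF : Fn 19
respondF =
  ifz opᵛ (twoF (assignF leftF)) (ifz (preF opᵛ) (twoF (assignF rightF))
    (ifz (preF (preF opᵛ)) (twoF (assignF (writeF true)))
    (ifz (preF (preF (preF opᵛ))) (twoF (assignF (writeF false)))
    (ifz (preF (preF (preF (preF opᵛ)))) (fourF branchF)
    (ifz (preF (preF (preF (preF (preF opᵛ))))) (fourF oracleF)
    (ifz (preF (preF (preF (preF (preF (preF opᵛ)))))) (ifz t₄ haltF (ifz t₅ queryF haltF))
    haltF))))))

module _ (k : Mode) (τ : Task) (p : ℕ) (log : Log) where

  private
    responds : Fn 19 → List ℕ → Instr → Set
    responds f is i = ⟦ f ⟧ (env k τ p log is) ≡ code (respond k τ p log i)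

  assignF-eval : ∀ f (g : Tape → Tape) op t → (∀ T → ⟦ f ⟧ (⌜ T ⌝ ∷ []) ≡ ⌜ g T ⌝) →
    ⟦ assignF f ⟧ (env k τ p log (op ∷ t ∷ []))
    ≡ code (goto (state k τ (suc p) ((t , g (tapes log t)) ∷ log)))
  assignF-eval f g op t f≡g =
    gotoF-eval ρ (stateF kᵛ bᵛ rᵛ eᵛ (sucF pᵛ) log′ ηeᵛ ηmᵛ)
      (stateF-eval ρ kᵛ bᵛ rᵛ eᵛ (sucF pᵛ) log′ ηeᵛ ηmᵛ {k} refl refl refl refl refl log≡ refl refl)
    where
    ρ : Vec ℕ 19
    ρ = env k τ p log (op ∷ t ∷ [])
    log′ : Fn 19
    log′ = call consF (call pairF (x₁ ∷ call f (tapeF x₁ ∷ []) ∷ []) ∷ lᵛ ∷ [])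
    log≡ : ⟦ log′ ⟧ ρ ≡ ⌜ (t , g (tapes log t)) ∷ log ⌝ˡ
    log≡ rewrite lookF-eval log t | f≡g (tapes log t) | pairF-eval t ⌜ g (tapes log t) ⌝ =
      cons-encode (entry (t , g (tapes log t))) (map entry log)

  value-eval : ∀ t → ⟦ valueF ⟧ (⟦ lookF ⟧ (⌜ log ⌝ˡ ∷ t ∷ []) ∷ []) ≡ value (tapes log t)
  value-eval t = trans (cong (λ n → ⟦ valueF ⟧ (n ∷ [])) (lookF-eval log t)) (valueF-eval (tapes log t))

  branchF-eval : ∀ op t x y → responds branchF (op ∷ t ∷ x ∷ y ∷ []) (branch t x y)
  branchF-eval op t x y =
    gotoF-eval ρ (jumpF kᵛ target) (stateF-eval ρ kᵛ bᵛ rᵛ eᵛ target lᵛ ηeᵛ ηmᵛ {k} refl refl refl refl target≡ refl refl refl)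
    where
    ρ : Vec ℕ 19
    ρ = env k τ p log (op ∷ t ∷ x ∷ y ∷ [])
    target : Fn 19
    target = ifz (call scanF (tapeF x₁ ∷ [])) x₃ x₂
    target≡ : ⟦ target ⟧ ρ ≡ (if scan (tapes log t) then x else y)
    target≡ rewrite lookF-eval log t | scanF-eval (tapes log t) with scan (tapes log t)
    ... | true  = refl
    ... | false = refl

  oracleF-eval : ∀ op t x y → responds oracleF (op ∷ t ∷ x ∷ y ∷ []) (oracle t x y)
  oracleF-eval op t x y =
    lookUpF-eval ρ position (jumpF kᵛ x₂) (jumpF kᵛ x₃) position≡
      (stateF-eval ρ kᵛ bᵛ rᵛ eᵛ x₂ lᵛ ηeᵛ ηmᵛ {k} refl refl refl refl refl refl refl refl)
      (stateF-eval ρ kᵛ bᵛ rᵛ eᵛ x₃ lᵛ ηeᵛ ηmᵛ {k} refl refl refl refl refl refl refl refl)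
    where
    ρ : Vec ℕ 19
    ρ = env k τ p log (op ∷ t ∷ x ∷ y ∷ [])
    v position : Fn 19
    v = call valueF (tapeF x₁ ∷ [])
    position = call addF (bᵛ ∷ call addF (v ∷ v ∷ []) ∷ [])
    position≡ : ⟦ position ⟧ ρ ≡ bit (Task.side τ) + (value (tapes log t) + value (tapes log t))
    position≡ rewrite value-eval t | addF-eval (value (tapes log t)) (value (tapes log t)) = addF-eval _ _

haltF-eval : ∀ k τ p log is → ⟦ haltF ⟧ (env k τ p log is) ≡ code (respond k τ p log halt)
haltF-eval simulate τ p log is = finishF-eval (env simulate τ p log is) zer refl
haltF-eval compare  τ p log is = gotoF-eval (env compare τ p log is) sᵛ refl
haltF-eval resume   τ p log is = gotoF-eval (env resume τ p log is) sᵛ refl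

consult-eval : ∀ k τ p log → k ≢ compare → ∀ op t u x y →
  ⟦ resumeF ⟧ (env k τ p log (op ∷ t ∷ u ∷ x ∷ y ∷ []))
  ≡ code (respond k τ p log (query t u x y))
consult-eval k τ@(task b r e η) p log k≢ op t u x y =
  trans (askForF-eval ρ rᵛ (launchF zer bᵛ rᵛ vt vu zer zer) (jumpF k′ x₃) (jumpF k′ x₄) refl
          (launchF-eval ρ zer bᵛ rᵛ vt vu zer zer {simulate} {b} refl refl refl
            (value-eval k τ p log t) (value-eval k τ p log u) refl refl)
          (stateF-eval ρ k′ bᵛ rᵛ eᵛ x₃ lᵛ ηeᵛ ηmᵛ {afterAnswer k} {b} {log′ = log}
            (after k) refl refl refl refl refl refl refl)
          (stateF-eval ρ k′ bᵛ rᵛ eᵛ x₄ lᵛ ηeᵛ ηmᵛ {afterAnswer k} {b} {log′ = log}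
            (after k) refl refl refl refl refl refl refl))
        (respond≡ k k≢)
  where
  ρ : Vec ℕ 19
  ρ = env k τ p log (op ∷ t ∷ u ∷ x ∷ y ∷ [])
  vt vu k′ : Fn 19
  vt = call valueF (tapeF x₁ ∷ [])
  vu = call valueF (tapeF x₂ ∷ [])
  k′ = ifz kᵛ zer (sucF zer)
  after : ∀ k → ifZero ⌜ k ⌝ᵐ 0 1 ≡ ⌜ afterAnswer k ⌝ᵐ
  after simulate = refl
  after compare  = refl
  after resume   = refl
  respond≡ : ∀ k → k ≢ compare →
    code (askFor r (launch simulate (task b r (value (tapes log t)) (0 , 0)) (value (tapes log u)))
      (state (afterAnswer k) τ x log) (state (afterAnswer k) τ y log))
    ≡ code (respond k τ p log (query t u x y))
  respond≡ simulate _  = refl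
  respond≡ compare  k≢ = contradiction refl k≢
  respond≡ resume   _  = refl

queryF-eval : ∀ k τ p log op t u x y →
  ⟦ queryF ⟧ (env k τ p log (op ∷ t ∷ u ∷ x ∷ y ∷ []))
  ≡ code (respond k τ p log (query t u x y))
queryF-eval simulate τ p log op t u x y = consult-eval simulate τ p log (λ ()) op t u x y
queryF-eval resume   τ p log op t u x y = consult-eval resume τ p log (λ ()) op t u x y
queryF-eval compare  τ@(task b r e η) p log op t u x y =
  askForF-eval ρ rᵛ (launchF (sucF zer) b′ rᵛ ηeᵛ ηmᵛ vt vu) (jumpF (numF 2) pᵛ) (stateF zer bᵛ rᵛ zer pᵛ lᵛ ηeᵛ ηmᵛ) refl
    (launchF-eval ρ (sucF zer) b′ rᵛ ηeᵛ ηmᵛ vt vu {compare} {not b} refl (flip b) refl refl refl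
      (value-eval compare τ p log t) (value-eval compare τ p log u))
    (stateF-eval ρ (numF 2) bᵛ rᵛ eᵛ pᵛ lᵛ ηeᵛ ηmᵛ {resume} {b} {log′ = log}
      refl refl refl refl refl refl refl refl)
    (stateF-eval ρ zer bᵛ rᵛ zer pᵛ lᵛ ηeᵛ ηmᵛ {simulate} {b} {log′ = log}
      refl refl refl refl refl refl refl refl)
  where
  ρ : Vec ℕ 19
  ρ = env compare τ p log (op ∷ t ∷ u ∷ x ∷ y ∷ [])
  vt vu b′ : Fn 19
  vt = call valueF (tapeF x₁ ∷ [])
  vu = call valueF (tapeF x₂ ∷ [])
  b′ = ifz bᵛ (sucF zer) zer
  flip : ∀ b → ifZero (bit b) 1 0 ≡ bit (not b)
  flip true  = refl
  flip false = refl

respondF-eval : ∀ k τ p log is →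
  ⟦ respondF ⟧ (env k τ p log is) ≡ code (respond k τ p log (decodeInstr is))
respondF-eval k τ p log [] = haltF-eval k τ p log []
respondF-eval k τ p log is@(0 ∷ []) = haltF-eval k τ p log is
respondF-eval k τ p log (0 ∷ t ∷ []) = assignF-eval k τ p log leftF moveLeft 0 t leftF-eval
respondF-eval k τ p log is@(0 ∷ _ ∷ _ ∷ _) = haltF-eval k τ p log is
respondF-eval k τ p log is@(1 ∷ []) = haltF-eval k τ p log is
respondF-eval k τ p log (1 ∷ t ∷ []) = assignF-eval k τ p log rightF moveRight 1 t rightF-eval
respondF-eval k τ p log is@(1 ∷ _ ∷ _ ∷ _) = haltF-eval k τ p log is
respondF-eval k τ p log is@(2 ∷ []) = haltF-eval k τ p log is
respondF-eval k τ p log (2 ∷ t ∷ []) = assignF-eval k τ p log (writeF true) (write true) 2 t (writeF-eval true)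
respondF-eval k τ p log is@(2 ∷ _ ∷ _ ∷ _) = haltF-eval k τ p log is
respondF-eval k τ p log is@(3 ∷ []) = haltF-eval k τ p log is
respondF-eval k τ p log (3 ∷ t ∷ []) = assignF-eval k τ p log (writeF false) (write false) 3 t (writeF-eval false)
respondF-eval k τ p log is@(3 ∷ _ ∷ _ ∷ _) = haltF-eval k τ p log is
respondF-eval k τ p log is@(4 ∷ []) = haltF-eval k τ p log is
respondF-eval k τ p log is@(4 ∷ _ ∷ []) = haltF-eval k τ p log is
respondF-eval k τ p log is@(4 ∷ _ ∷ _ ∷ []) = haltF-eval k τ p log is
respondF-eval k τ p log (4 ∷ t ∷ x ∷ y ∷ []) = branchF-eval k τ p log 4 t x y
respondF-eval k τ p log is@(4 ∷ _ ∷ _ ∷ _ ∷ _ ∷ _) = haltF-eval k τ p log is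
respondF-eval k τ p log is@(5 ∷ []) = haltF-eval k τ p log is
respondF-eval k τ p log is@(5 ∷ _ ∷ []) = haltF-eval k τ p log is
respondF-eval k τ p log is@(5 ∷ _ ∷ _ ∷ []) = haltF-eval k τ p log is
respondF-eval k τ p log (5 ∷ t ∷ x ∷ y ∷ []) = oracleF-eval k τ p log 5 t x y
respondF-eval k τ p log is@(5 ∷ _ ∷ _ ∷ _ ∷ _ ∷ _) = haltF-eval k τ p log is
respondF-eval k τ p log is@(6 ∷ []) = haltF-eval k τ p log is
respondF-eval k τ p log is@(6 ∷ _ ∷ []) = haltF-eval k τ p log is
respondF-eval k τ p log is@(6 ∷ _ ∷ _ ∷ []) = haltF-eval k τ p log is
respondF-eval k τ p log is@(6 ∷ _ ∷ _ ∷ _ ∷ []) = haltF-eval k τ p log is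
respondF-eval k τ p log (6 ∷ t ∷ u ∷ x ∷ y ∷ []) = queryF-eval k τ p log 6 t u x y
respondF-eval k τ p log is@(6 ∷ _ ∷ _ ∷ _ ∷ _ ∷ _ ∷ _) = haltF-eval k τ p log is
respondF-eval k τ p log is@(suc (suc (suc (suc (suc (suc (suc _)))))) ∷ _) = haltF-eval k τ p log is

dropF : ℕ → Fn 1
dropF zero    = v₀
dropF (suc k) = call (dropF k) (tlF ∷ [])

dropF-encode : ∀ k xs → ⟦ dropF k ⟧ (encode xs ∷ []) ≡ encode (drop k xs)
dropF-encode zero    xs       = refl
dropF-encode (suc k) []       =
  trans (cong (λ n → ⟦ dropF k ⟧ (n ∷ [])) tl-nil) (trans (dropF-encode k []) (cong encode (drop-[] k)))
  where
  drop-[] : ∀ k → drop k [] ≡ []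
  drop-[] zero    = refl
  drop-[] (suc k) = refl
dropF-encode (suc k) (x ∷ xs) =
  trans (cong (λ n → ⟦ dropF k ⟧ (n ∷ [])) (tl-encode x xs)) (dropF-encode k xs)

fieldF : ℕ → Fn 1
fieldF k = call (nthF k) (v₀ ∷ [])

instructionF : Fn 1
instructionF = call fetchF (fieldF 3 ∷ fieldF 4 ∷ [])

argumentsF : Vec (Fn 1) 19
argumentsF =
  fieldF 0 ∷ fieldF 1 ∷ fieldF 2 ∷ fieldF 3 ∷ fieldF 4 ∷ fieldF 5 ∷ fieldF 6 ∷ fieldF 7 ∷ v₀
  ∷ rest 1 ∷ rest 2 ∷ rest 3 ∷ rest 4 ∷ rest 5 ∷ part 0 ∷ part 1 ∷ part 2 ∷ part 3 ∷ part 4 ∷ []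
  where
  rest part : ℕ → Fn 1
  rest k = call (dropF k) (instructionF ∷ [])
  part k = call (nthF k) (instructionF ∷ [])

opaque
  interpretF : Fn 1
  interpretF = call respondF argumentsF

  interpretF-eval : ∀ k τ p log →
    ⟦ interpretF ⟧ (state k τ p log ∷ []) ≡ code (respond k τ p log (fetch (program (Task.e τ)) p))
  interpretF-eval k τ@(task b r e (ηe , ηm)) p log =
    trans (cong ⟦ respondF ⟧ arguments≡)
      (trans (respondF-eval k τ p log (instruction e p))
        (cong (λ i → code (respond k τ p log i)) (sym (fetch-decode (decode e) p))))
    where
    s : ℕ
    s = state k τ p log
    field≡ : ∀ j → ⟦ nthF j ⟧ (s ∷ []) ≡ nth (stateFields k τ p log) j
    field≡ j = trans (cong (λ n → ⟦ nthF j ⟧ (n ∷ [])) (state-fields k τ p log)) (nthF-encode j (stateFields k τ p log))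
    instruction≡ : ⟦ instructionF ⟧ (s ∷ []) ≡ encode (instruction e p)
    instruction≡ = trans (cong₂ (λ a b → ⟦ fetchF ⟧ (a ∷ b ∷ [])) (field≡ 3) (field≡ 4)) (fetchF-instruction e p)
    rest≡ : ∀ j → ⟦ dropF j ⟧ (⟦ instructionF ⟧ (s ∷ []) ∷ []) ≡ encode (drop j (instruction e p))
    rest≡ j = trans (cong (λ n → ⟦ dropF j ⟧ (n ∷ [])) instruction≡) (dropF-encode j (instruction e p))
    part≡ : ∀ j → ⟦ nthF j ⟧ (⟦ instructionF ⟧ (s ∷ []) ∷ []) ≡ nth (instruction e p) j
    part≡ j = trans (cong (λ n → ⟦ nthF j ⟧ (n ∷ [])) instruction≡) (nthF-encode j (instruction e p))
    arguments≡ : ⟦ argumentsF ⟧* (s ∷ []) ≡ env k τ p log (instruction e p)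
    arguments≡ =
      cong₂ _∷_ (field≡ 0) (cong₂ _∷_ (field≡ 1) (cong₂ _∷_ (field≡ 2) (cong₂ _∷_ (field≡ 3)
      (cong₂ _∷_ (field≡ 4) (cong₂ _∷_ (field≡ 5) (cong₂ _∷_ (field≡ 6) (cong₂ _∷_ (field≡ 7)
      (cong (s ∷_) (cong₂ _∷_ (rest≡ 1) (cong₂ _∷_ (rest≡ 2) (cong₂ _∷_ (rest≡ 3) (cong₂ _∷_ (rest≡ 4)
      (cong₂ _∷_ (rest≡ 5) (cong₂ _∷_ (part≡ 0) (cong₂ _∷_ (part≡ 1) (cong₂ _∷_ (part≡ 2)
      (cong₂ _∷_ (part≡ 3) (cong₂ _∷_ (part≡ 4) refl))))))))))))))))))

-- Correctness of the interpreter over the join of two oracles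

double : ∀ v → v + v ≡ v * 2
double v = trans (cong (v +_) (sym (+-identityʳ v))) (*-comm 2 v)

⊕-even : ∀ X Y v → (X ⊕ Y) (v + v) ≡ X v
⊕-even X Y v = trans (cong (X ⊕ Y) (double v)) (lemma (v * 2) (m*n%n≡0 v 2) (m*n/n≡m v 2))
  where
  lemma : ∀ n → n % 2 ≡ 0 → n / 2 ≡ v → (X ⊕ Y) n ≡ X v
  lemma n even half rewrite even | half = refl

⊕-odd : ∀ X Y v → (X ⊕ Y) (suc (v + v)) ≡ Y v
⊕-odd X Y v = trans (cong (X ⊕ Y ∘ suc) (double v))
  (lemma (1 + v * 2) ([m+kn]%n≡m%n 1 v 2) (trans (+-distrib-/-∣ʳ 1 {v * 2} {2} (divides v refl)) (m*n/n≡m v 2)))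
  where
  lemma : ∀ n → n % 2 ≡ 1 → n / 2 ≡ v → (X ⊕ Y) n ≡ Y v
  lemma n odd half rewrite odd | half = refl

self : ℕ
self = index (Machine.machine interpretF)

module _ (X Y : Oracle) where

  private
    Z : Oracle
    Z = X ⊕ Y

  oracleOf : Bool → Oracle
  oracleOf true  = Y
  oracleOf false = X

  oracleOf-⊕ : ∀ b v → Z (bit b + (v + v)) ≡ oracleOf b v
  oracleOf-⊕ true  = ⊕-odd X Y
  oracleOf-⊕ false = ⊕-even X Y

  open Machine interpretF using (convergent; divergent)

  infix 4 _⟶_
  _⟶_ : ℕ → ℕ → Set
  _⟶_ = Machine._⟶_ interpretF I∞ Z

  Finishes : ℕ → Set
  Finishes s = ⟦ interpretF ⟧ (s ∷ []) ≡ code (finish 0)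

  Tracks : Mode → Task → Config → ℕ → Set
  Tracks k τ (p , T) s = ∃[ log ] s ≡ state k τ p log × ∀ t → T t ≡ tapes log t

  stopped : Task → Task
  stopped (task b r e η) = task b r 0 η

  rivalTask : Task → ℕ → ℕ → Task
  rivalTask (task b r e (ηe , ηm)) e′ m′ = task (not b) r ηe (e′ , m′)

  subTask : Task → ℕ → Task
  subTask (task b r e η) e′ = task b r e′ (0 , 0)

  rivalCall subCall : Task → ℕ → ℕ → Computation
  rivalCall τ e m = Task.self τ , launch compare (rivalTask τ e m) (proj₂ (Task.rival τ)) , Z
  subCall   τ e m = Task.self τ , launch simulate (subTask τ e) m , Z

  -- Here `o` is the outcome of the simulation and `o′` that of the simulated query. Their outputs
  -- may differ, but the answer depends on convergence alone. A converging comparison leaves the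
  -- simulated configuration `c` where it is; only the mode changes.
  Asks : Mode → Task → ℕ → ℕ → ℕ → (Answer → Config) → Config → Set
  Asks compare τ s e m κ c =
    (∀ {n} → I∞ (rivalCall τ e m) (↓ n) → ∃[ s′ ] s ⟶ s′ × Tracks resume τ c s′)
    × (I∞ (rivalCall τ e m) ↑ → ∃[ s′ ] s ⟶ s′ × Finishes s′)
  Asks k τ s e m κ c =
    ∀ o o′ → isConvergent o ≡ isConvergent o′ → I∞ (subCall τ e m) o →
    ∃[ s′ ] s ⟶ s′ × Tracks (afterAnswer k) τ (κ (answer o′)) s′

  Stops : Mode → ℕ → Set
  Stops simulate s = Finishes s
  Stops _        s = s ⟶ s

  Reacts : Mode → Task → ℕ → Config → Action → Set
  Reacts k τ s c (next c′)   = ∃[ s′ ] s ⟶ s′ × Tracks k τ c′ s′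
  Reacts k τ s c (ask e m κ) = Asks k τ s e m κ c
  Reacts k τ s c (stop _)    = Stops k s

  agree-≔ : ∀ {T : Tapes} log t (f : Tape → Tape) → (∀ u → T u ≡ tapes log u) →
    ∀ u → (T [ t ≔ f (T t) ]) u ≡ tapes ((t , f (tapes log t)) ∷ log) u
  agree-≔ log t f agree u with u ≡ᵇ t
  ... | true  = cong f (agree t)
  ... | false = agree u

  reacts : ∀ k τ c s → Tracks k τ c s →
    Reacts k τ s c (action (program (Task.e τ)) (oracleOf (Task.side τ)) c)
  reacts k τ (p , T) .(state k τ p log) (log , refl , agree)
    with fetch (program (Task.e τ)) p | interpretF-eval k τ p log
  ... | left t         | F≡ = _ , (_ , F≡ , Machine.goto) , _ , refl , agree-≔ log t moveLeft agree
  ... | right t        | F≡ = _ , (_ , F≡ , Machine.goto) , _ , refl , agree-≔ log t moveRight agree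
  ... | mark t         | F≡ = _ , (_ , F≡ , Machine.goto) , _ , refl , agree-≔ log t (write true) agree
  ... | erase t        | F≡ = _ , (_ , F≡ , Machine.goto) , _ , refl , agree-≔ log t (write false) agree
  ... | branch t x y   | F≡ rewrite agree t = _ , (_ , F≡ , Machine.goto) , _ , refl , agree
  ... | oracle t x y   | F≡ rewrite agree t = _ , (_ , F≡ , Machine.lookUp) , log , target , agree
    where
    v = value (tapes log t)
    choice : ∀ b → (if b then state k τ x log else state k τ y log) ≡ state k τ (if b then x else y) log
    choice true  = refl
    choice false = refl
    target = trans (cong (λ b → if b then state k τ x log else state k τ y log) (oracleOf-⊕ (Task.side τ) v))
                   (choice _)
  reacts simulate τ (p , T) _ (log , refl , agree) | query t u x y | F≡ rewrite agree t | agree u = λ where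
    (↓ _) (↓ _) _ Io → _ , (_ , F≡ , Machine.askFor _ Io) , log , refl , agree
    ↑     ↑     _ Io → _ , (_ , F≡ , Machine.askFor _ Io) , log , refl , agree
  reacts resume τ (p , T) _ (log , refl , agree) | query t u x y | F≡ rewrite agree t | agree u = λ where
    (↓ _) (↓ _) _ Io → _ , (_ , F≡ , Machine.askFor _ Io) , log , refl , agree
    ↑     ↑     _ Io → _ , (_ , F≡ , Machine.askFor _ Io) , log , refl , agree
  reacts compare τ (p , T) _ (log , refl , agree) | query t u x y | F≡ rewrite agree t | agree u =
    (λ Io → _ , (_ , F≡ , Machine.askFor _ Io) , log , refl , agree) ,
    (λ Io → _ , (_ , F≡ , Machine.askFor _ Io) , interpretF-eval simulate (stopped τ) p log)
  reacts simulate τ _ _ _ | halt | F≡ = F≡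
  reacts compare  τ _ _ _ | halt | F≡ = _ , F≡ , Machine.goto
  reacts resume   τ _ _ _ | halt | F≡ = _ , F≡ , Machine.goto

  Sim : Task → Graph → Config → Config → Set
  Sim τ C = Step C (program (Task.e τ)) (oracleOf (Task.side τ))

  -- Each simulated step costs at least one step of the interpreter, so endless runs stay endless.
  Preserved : Mode → Task → Graph → Set
  Preserved k τ C = ∀ {c c′ s} → Sim τ C c c′ → Tracks k τ c s → ∃[ s′ ] Plus _⟶_ s s′ × Tracks k τ c′ s′

  launch-tracks : ∀ k τ m → Tracks k τ (start m) (launch k τ m)
  launch-tracks k τ m = _ , refl , λ t → refl

  follow : ∀ {k τ C} → Preserved k τ C → ∀ {c c′ s} → Star (Sim τ C) c c′ → Tracks k τ c s →
    ∃[ s′ ] Star _⟶_ s s′ × Tracks k τ c′ s′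
  follow preserved ε              tr = _ , ε , tr
  follow preserved (step ◅ steps) tr =
    let _ , (_ , move , moves) , tr₁ = preserved step tr
        _ , moves₂ , tr₂ = follow preserved steps tr₁
    in _ , move ◅ moves ◅◅ moves₂ , tr₂

  follow-forever : ∀ {k τ C m} → Preserved k τ C → (c : ℕ → Config) → c 0 ≡ start m →
    (∀ n → Sim τ C (c n) (c (suc n))) → I∞ (self , launch k τ m , Z) ↑
  follow-forever {k} {τ} {m = m} preserved c c0 steps =
    fix (divergent I∞ Z {Inv = λ s → ∃[ n ] Tracks k τ (c n) s}
      (λ (n , tr) → let _ , moves , tr₁ = preserved (steps n) tr in _ , moves , suc n , tr₁)
      (_ , ε , 0 , subst (λ c → Tracks k τ c (launch k τ m)) (sym c0) (launch-tracks k τ m)))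

  react : ∀ {k τ c s a} → Tracks k τ c s → action (program (Task.e τ)) (oracleOf (Task.side τ)) c ≡ a →
    Reacts k τ s c a
  react {k} {τ} {c} {s} tr eq = subst (Reacts k τ s c) eq (reacts k τ c s tr)

  Earlier : Ord → Graph
  Earlier α γ o = ∃[ β ] (β <ᵒ α × I β γ o)

  -- D α γ says that ρ(γ) ≤ α.
  D : Ord → Computation → Set
  D α γ = ∃[ o ] I α γ o

  mutual
    -- Induction on the stage: queries answered at earlier stages are simulated with the same
    -- convergence, which is all that the run depends on. The rival `η` is arbitrary because mode
    -- `simulate` ignores it.
    simulates : ∀ {α} → Acc _<ᵒ_ α → ∀ b e η m o → I α (e , m , oracleOf b) o →
      ∃[ o′ ] isConvergent o′ ≡ isConvergent o × I∞ (self , launch simulate (task b self e η) m , Z) o′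
    simulates ac b e η m _ (stage (halts steps stops)) =
      let _ , moves , tr = follow (simulate-preserved ac b e η) steps (launch-tracks simulate (task b self e η) m)
      in ↓ 0 , refl , fix (convergent I∞ Z moves (react tr stops))
    simulates ac b e η m _ (stage (runs-forever c c0 steps)) =
      ↑ , refl , follow-forever (simulate-preserved ac b e η) c c0 steps

    simulate-preserved : ∀ {α} → Acc _<ᵒ_ α → ∀ b e η → Preserved simulate (task b self e η) (Earlier α)
    simulate-preserved _        b e η (compute eq) tr = let s , move , tr₁ = react tr eq in s , (s , move , ε) , tr₁
    simulate-preserved (acc rs) b e η (feed {e′} {m′} {o = o} eq (β , β<α , Iβ)) tr =
      let o′ , conv , Io′ = simulates (rs β<α) b e′ (0 , 0) m′ o Iβ
          s , move , tr₁ = react tr eq o′ o conv Io′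
      in s , (s , move , ε) , tr₁

  -- A query in mode `compare` takes two steps: `won` lets the machine go on to ask the simulator,
  -- and `Iβ` guarantees that the simulator has an outcome.
  proceed : ∀ {β b e η c s e′ m′ κ o n} → let τ = task b self e η in
    Tracks compare τ c s → action (program e) (oracleOf b) c ≡ ask e′ m′ κ →
    I β (e′ , m′ , oracleOf b) o → I∞ (rivalCall τ e′ m′) (↓ n) →
    ∃[ s′ ] Plus _⟶_ s s′ × Tracks compare τ (κ (answer o)) s′
  proceed {b = b} {e′ = e′} {m′} {o = o} tr eq Iβ won =
    let o′ , conv , Io′ = simulates (<ᵒ-wellFounded _) b e′ (0 , 0) m′ o Iβ
        s₁ , move₁ , tr₁ = proj₁ (react tr eq) won
        s₂ , move₂ , tr₂ = react tr₁ eq o′ o conv Io′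
    in s₂ , (s₁ , move₁ , move₂ ◅ ε) , tr₂

-- Comparison of ranks

≤ᵒ-refl : ∀ α → α ≤ᵒ α
≤ᵒ-refl zero     = z≤
≤ᵒ-refl (sup⁺ f) = sup≤ λ i → <sup i (≤ᵒ-refl (f i))

<ᵒ⇒≤ᵒ : ∀ {α β} → α <ᵒ β → α ≤ᵒ β
<ᵒ⇒≤ᵒ {zero}   _                  = z≤
<ᵒ⇒≤ᵒ {sup⁺ g} (<sup i (sup≤ g<)) = sup≤ λ j → <sup i (<ᵒ⇒≤ᵒ (g< j))

<ᵒ-irrefl : ∀ {α} → ¬ (α <ᵒ α)
<ᵒ-irrefl {α} = go (<ᵒ-wellFounded α)
  where
  go : ∀ {α} → Acc _<ᵒ_ α → ¬ (α <ᵒ α)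
  go (acc rs) α<α = go (rs α<α) α<α

module _ (em : ExcludedMiddle 0ℓ) where

  -- If `C` answered every query reached, the run could always be continued until it halts, and so
  -- would halt or run forever; either way it would have an outcome.
  stuck : ∀ {C : Graph} {e m O} → ¬ (∃[ o ] Γ C (e , m , O) o) →
    ∃[ c ] Star (Step C (program e) O) (start m) c
    × ∃[ e′ ] ∃[ m′ ] ∃[ κ ] action (program e) O c ≡ ask e′ m′ κ × ¬ (∃[ o ] C (e′ , m′ , O) o)
  stuck {C} {e} {m} {O} undef with em {∃[ c ] Star (Step C (program e) O) (start m) c
    × ∃[ e′ ] ∃[ m′ ] ∃[ κ ] action (program e) O c ≡ ask e′ m′ κ × ¬ (∃[ o ] C (e′ , m′ , O) o)}
  ... | yes found = found
  ... | no  none  =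
    let f , f0 , steps = forever (Step C (program e) O) progress (start m , ε , ε)
    in contradiction (↑ , runs-forever f f0 steps) undef
    where
    progress : Progress (Step C (program e) O) (Star (Step C (program e) O) (start m))
    progress {c} reach with action (program e) O c in eq
    ... | next c′ = c′ , (c′ , compute eq , ε) , reach ◅◅ compute eq ◅ ε
    ... | stop k  = contradiction (↓ k , halts reach eq) undef
    ... | ask e′ m′ κ with em {∃[ o ] C (e′ , m′ , O) o}
    ...   | yes (o , Co) = _ , (_ , feed eq Co , ε) , reach ◅◅ feed eq Co ◅ ε
    ...   | no  ¬C       = contradiction (c , reach , e′ , m′ , κ , eq , ¬C) none

  module _ (X Y : Oracle) where

    private
      _⇒_ : ℕ → ℕ → Set
      _⇒_ = _⟶_ X Y

      rank≤ : Ord → ℕ × ℕ → Bool → Set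
      rank≤ α (e , m) b = D X Y α (e , m , oracleOf X Y b)

    -- Excluded middle and well-founded descent turn an upper bound into the exact rank, which the
    -- divergent case needs as a lower bound for its rival.
    minimal : ∀ {α β} ξ b → Acc _<ᵒ_ β → β <ᵒ α → rank≤ β ξ b →
      ∃[ β₀ ] β₀ <ᵒ α × rank≤ β₀ ξ b × (∀ β′ → β′ <ᵒ β₀ → ¬ rank≤ β′ ξ b)
    minimal {α} {β} ξ b (acc rs) β<α Dβ with em {∃[ β′ ] β′ <ᵒ β × rank≤ β′ ξ b}
    ... | yes (β′ , β′<β , Dβ′) = minimal ξ b (rs β′<β) (≤ᵒ-<ᵒ-trans (<ᵒ⇒≤ᵒ β′<β) β<α) Dβ′
    ... | no  none = β , β<α , Dβ , λ β′ β′<β Dβ′ → none (β′ , β′<β , Dβ′)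

    compareCall : Bool → ℕ × ℕ → ℕ × ℕ → Computation
    compareCall b (e , m) η = self , launch compare (task b self e η) m , X ⊕ Y

    mutual
      -- The hypotheses say `ρ(ξ) ≤ α ≤ ρ(η)`. A query of `ξ` answered at a stage `β` below `α`
      -- satisfies `ρ(ξ′) ≤ β < ρ(η)`, so with roles exchanged the convergent case at `β` lets the
      -- run continue past it.
      diverges-≤ : ∀ {α} → Acc _<ᵒ_ α → ∀ b ξ η → rank≤ α ξ b → (∀ β → β <ᵒ α → ¬ rank≤ β η (not b)) →
        I∞ (compareCall b ξ η) ↑
      diverges-≤ {α} (acc rs) b ξ@(e , m) η (_ , stage run) slower = go run
        where
        τ : Task
        τ = task b self e η
        preserved : Preserved X Y compare τ (Earlier X Y α)
        preserved (compute eq) tr = let s , move , tr₁ = react X Y tr eq in s , (s , move , ε) , tr₁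
        preserved (feed {e′} {m′} eq (β , β<α , Iβ)) tr =
          let n , won = converges-> (rs β<α) (not b) η (e′ , m′)
                          (subst (rank≤ β (e′ , m′)) (sym (not-involutive b)) (_ , Iβ)) (slower β β<α)
          in proceed X Y tr eq Iβ won
        go : ∀ {o} → Γ (Earlier X Y α) (e , m , oracleOf X Y b) o → I∞ (compareCall b ξ η) ↑
        go (runs-forever c c0 steps) = follow-forever X Y preserved c c0 steps
        go (halts steps stops) =
          let s , moves , tr = follow X Y preserved steps (launch-tracks X Y compare τ m)
              again = react X Y tr stops
          in fix (Machine.divergent interpretF I∞ (X ⊕ Y) {Inv = λ s → s ⇒ s}
               (λ {s} loops → s , (s , loops , ε) , loops) (s , moves , again))

      -- The hypotheses say `ρ(η) ≤ α < ρ(ξ)`. Having no outcome at stage `α`, the run of `ξ`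
      -- reaches a query with no outcome below `α`, where the comparison diverges, unless an earlier
      -- query has already halted the machine.
      converges-> : ∀ {α} → Acc _<ᵒ_ α → ∀ b ξ η → rank≤ α η (not b) → ¬ rank≤ α ξ b →
        ∃[ n ] I∞ (compareCall b ξ η) (↓ n)
      converges-> {α} ac@(acc rs) b ξ@(e , m) η Dη ¬Dξ =
        let c , steps , e′ , m′ , κ , eq , ¬Iξ′ = stuck λ (o , run) → ¬Dξ (o , stage run)
            -- The ordinal does not decrease here; the recursion is well founded because
            -- `diverges-≤` calls back only below `α`.
            lost = diverges-≤ ac (not b) η (e′ , m′) Dη λ β β<α Dβ →
                     let o , Iβ = subst (rank≤ β (e′ , m′)) (not-involutive b) Dβ in ¬Iξ′ (o , β , β<α , Iβ)
            s , moves , finishes = go eq lost steps (launch-tracks X Y compare τ m)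
        in 0 , fix (Machine.convergent interpretF I∞ (X ⊕ Y) moves finishes)
        where
        τ : Task
        τ = task b self e η
        go : ∀ {c c′ s e′ m′ κ} → action (program e) (oracleOf X Y b) c′ ≡ ask e′ m′ κ →
          I∞ (rivalCall X Y τ e′ m′) ↑ → Star (Sim X Y τ (Earlier X Y α)) c c′ → Tracks X Y compare τ c s →
          ∃[ s′ ] Star _⇒_ s s′ × Finishes X Y s′
        go eq lost ε tr =
          let s , move , finishes = proj₂ (react X Y tr eq) lost in s , move ◅ ε , finishes
        go eq lost (compute eq₁ ◅ steps) tr =
          let _ , move , tr₁ = react X Y tr eq₁
              s , moves , finishes = go eq lost steps tr₁
          in s , move ◅ moves , finishes
        -- As `α` merely bounds `ρ(η)`, a query of rank below `α` may still have rank at least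
        -- `ρ(η)`. Its exact rank `β₀` decides: if `ρ(η) ≤ β₀`, the comparison diverges and the
        -- machine halts already here; otherwise it converges and the run goes on.
        go eq lost (feed {e₁} {m₁} eq₁ (β , β<α , Iβ) ◅ steps) tr
          with β₀ , β₀<α , Dβ₀ , least ← minimal (e₁ , m₁) b (<ᵒ-wellFounded β) β<α (_ , Iβ)
          with em {rank≤ β₀ η (not b)}
        ... | yes Dβ₀η =
          let lost₁ = diverges-≤ (rs β₀<α) (not b) η (e₁ , m₁) Dβ₀η λ β′ β′<β₀ Dβ′ →
                        least β′ β′<β₀ (subst (rank≤ β′ (e₁ , m₁)) (not-involutive b) Dβ′)
              s , move , finishes = proj₂ (react X Y tr eq₁) lost₁
          in s , move ◅ ε , finishes
        ... | no ¬Dβ₀η =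
          let n , won = converges-> (rs β₀<α) (not b) η (e₁ , m₁)
                          (subst (rank≤ β₀ (e₁ , m₁)) (sym (not-involutive b)) Dβ₀) ¬Dβ₀η
              _ , (_ , move , moves) , tr₁ = proceed X Y tr eq₁ Iβ won
              s , moves₁ , finishes = go eq lost steps tr₁
          in s , move ◅ moves ◅◅ moves₁ , finishes

-- The machine for `G`

callF asksF contestF : Fn 1
callF = launchF (sucF zer) zer (numF self) (nthF 0) (nthF 1) (nthF 2) (nthF 3)
asksF = askForF (numF self) callF (listF (sucF zer ∷ [])) zer
-- The final states are 0 and encode (1 ∷ []), with the output as head; they have
-- no tail, unlike the initial states.
contestF = ifz tlF (finishF hdF) asksF

contestF-start : ∀ e⁰ m⁰ e¹ m¹ → ⟦ contestF ⟧ (encode (e⁰ ∷ m⁰ ∷ e¹ ∷ m¹ ∷ []) ∷ [])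
  ≡ code (askFor self (launch compare (task false self e⁰ (e¹ , m¹)) m⁰) (encode (1 ∷ [])) 0)
contestF-start e⁰ m⁰ e¹ m¹ =
  trans (cong (λ n → ifZero n (⟦ finishF hdF ⟧ ρ) (⟦ asksF ⟧ ρ)) (tl-encode e⁰ (m⁰ ∷ e¹ ∷ m¹ ∷ [])))
    (askForF-eval ρ (numF self) callF (listF (sucF zer ∷ [])) zer (numF-eval self ρ)
      (launchF-eval ρ (sucF zer) zer (numF self) (nthF 0) (nthF 1) (nthF 2) (nthF 3) {compare} {false}
        refl refl (numF-eval self ρ) (nthF-encode 0 xs) (nthF-encode 1 xs) (nthF-encode 2 xs) (nthF-encode 3 xs))
      (listF-eval (sucF zer ∷ []) ρ) refl)
  where
  xs : List ℕ
  xs = e⁰ ∷ m⁰ ∷ e¹ ∷ m¹ ∷ []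
  ρ : Vec ℕ 1
  ρ = encode xs ∷ []

contestF-final : ∀ {s k} → tl s ≡ 0 → hd s ≡ k → ⟦ contestF ⟧ (s ∷ []) ≡ code (finish k)
contestF-final {s} tl≡ hd≡ =
  trans (cong (λ n → ifZero n (⟦ finishF hdF ⟧ (s ∷ [])) (⟦ asksF ⟧ (s ∷ []))) tl≡)
    (finishF-eval (s ∷ []) hdF hd≡)

contest : ℕ
contest = index (Machine.machine contestF)

module _ (em : ExcludedMiddle 0ℓ) (X Y : Oracle) (e⁰ m⁰ e¹ m¹ : ℕ) where

  private
    input : ℕ
    input = encode (e⁰ ∷ m⁰ ∷ e¹ ∷ m¹ ∷ [])

  -- A single query to the comparison turns the verdict, convergence or divergence, into an output;
  -- side `false` makes the first computation the one with oracle `X`.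
  contest-outcome : ∀ o → I∞ (compareCall em X Y false (e⁰ , m⁰) (e¹ , m¹)) o →
    ⟨ contest ⟩^ (X ⊕ Y) [ input ]≃ (if isConvergent o then 1 else 0)
  contest-outcome o Io = fix (Machine.convergent contestF I∞ (X ⊕ Y)
    ((_ , contestF-start e⁰ m⁰ e¹ m¹ , Machine.askFor o Io) ◅ ε) (final o))
    where
    final : ∀ o → ⟦ contestF ⟧ ((if isConvergent o then encode (1 ∷ []) else 0) ∷ [])
                  ≡ code (finish (if isConvergent o then 1 else 0))
    final (↓ _) = contestF-final (tl-encode 1 []) (hd-encode 1 [])
    final ↑     = contestF-final tl-nil hd-nil

  contest-≤ : ∀ {ργ ρδ} → Rank (e⁰ , m⁰ , X) ργ → Rank (e¹ , m¹ , Y) ρδ → ργ <⁺ ω₁ → ργ ≤⁺ ρδ →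
    ⟨ contest ⟩^ (X ⊕ Y) [ input ]≃ 0
  contest-≤ (defined Dγ _) δ [ α ]<⊤⁺ γ≤δ =
    contest-outcome ↑ (diverges-≤ em X Y (<ᵒ-wellFounded α) false (e⁰ , m⁰) (e¹ , m¹) Dγ (later δ γ≤δ))
    where
    later : ∀ {ρδ} → Rank (e¹ , m¹ , Y) ρδ → [ α ] ≤⁺ ρδ → ∀ β → β <ᵒ α → ¬ D X Y β (e¹ , m¹ , Y)
    later (defined _ least) [ α≤ ]  β β<α Dδ = <ᵒ-irrefl (≤ᵒ-<ᵒ-trans (≤ᵒ-trans α≤ (least β Dδ)) β<α)
    later (undefined ¬Dδ)   (_ ≤⊤⁺) β β<α Dδ = ¬Dδ β Dδ

  contest-> : ∀ {ργ ρδ} → Rank (e⁰ , m⁰ , X) ργ → Rank (e¹ , m¹ , Y) ρδ → ρδ <⁺ ω₁ → ρδ <⁺ ργ →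
    ⟨ contest ⟩^ (X ⊕ Y) [ input ]≃ 1
  contest-> γ (defined Dδ _) [ β ]<⊤⁺ δ<γ =
    let n , Io = converges-> em X Y (<ᵒ-wellFounded β) false (e⁰ , m⁰) (e¹ , m¹) Dδ (later γ δ<γ)
    in contest-outcome (↓ n) Io
    where
    later : ∀ {ργ} → Rank (e⁰ , m⁰ , X) ργ → [ β ] <⁺ ργ → ¬ D X Y β (e⁰ , m⁰ , X)
    later (defined _ least) [ β<α ]    Dγ = <ᵒ-irrefl (<ᵒ-≤ᵒ-trans β<α (least β Dγ))
    later (undefined ¬Dγ)   [ _ ]<⊤⁺ Dγ = ¬Dγ β Dγ

theorem2p26 : ExcludedMiddle 0ℓ →
    ∃[ g ] ∀ (X Y : Oracle) (e⁰ m⁰ e¹ m¹ : ℕ) (ργ ρδ : Ord ⁺) →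
    Rank (e⁰ , m⁰ , X) ργ → Rank (e¹ , m¹ , Y) ρδ →
    (ργ <⁺ ω₁ → ργ ≤⁺ ρδ → ⟨ g ⟩^ (X ⊕ Y) [ encode (e⁰ ∷ m⁰ ∷ e¹ ∷ m¹ ∷ []) ]≃ 0)
    × (ρδ <⁺ ω₁ → ρδ <⁺ ργ → ⟨ g ⟩^ (X ⊕ Y) [ encode (e⁰ ∷ m⁰ ∷ e¹ ∷ m¹ ∷ []) ]≃ 1)
theorem2p26 em = contest , λ X Y e⁰ m⁰ e¹ m¹ ργ ρδ γ δ →
  contest-≤ em X Y e⁰ m⁰ e¹ m¹ γ δ , contest-> em X Y e⁰ m⁰ e¹ m¹ γ δ
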